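{- Let $K$ be an infinite field, $\sigma$ a simplicial complex on $[n]=\{1,\dots,n\}$ and $\varphi\in GL_n(K)$. Then for every $S\subset[n]$, $$m_{\preceq_{rev}S}(\Delta(\sigma))\ \ge\ m_{\preceq_{rev}S}(\Delta(\Delta_\varphi(\sigma))).$$
   Context: $E$ is the exterior algebra over $K$ of the vector space with basis $e_1,\dots,e_n$; for $S=\{s_1<\dots<s_d\}$, $e_S=e_{s_1}\wedge\cdots\wedge e_{s_d}$. The reverse lexicographic order $\prec_{rev}$ on subsets of $[n]$ (induced by $1<2<\dots<n$): for $S\ne R$, $S\prec_{rev}R$ if $|S|<|R|$, or $|S|=|R|$ and the minimal element of the symmetric difference $(S\setminus R)\cup(R\setminus S)$ lies in $S$; it is used as a term order on $E$ via $e_S\prec_{rev}e_R\iff S\prec_{rev}R$. For $f=\sum\alpha_Se_S$, $\mathrm{in}_{\prec_{rev}}(f)$ is the $\prec_{rev}$-largest $e_S$ with $\alpha_S\ne0$, and $\mathrm{in}_{\prec_{rev}}(J)$ is the ideal generated by all initial monomials of elements of $J$. For $\varphi=(a_{ij})\in GL_n(K)$, $\varphi(f(e_1,\dots,e_n))=f(\sum_ia_{i1}e_i,\dots,\sum_ia_{in}e_i)$, $\varphi(J)=\{\varphi(f):f\in J\}$. The generic initial ideal $\mathrm{Gin}_{\prec_{rev}}(J)$ is the common value of $\mathrm{in}_{\prec_{rev}}(\varphi(J))$ for $\varphi$ in a nonempty Zariski open subset of $GL_n(K)$. The exterior face ideal $J_\sigma$ of a simplicial complex $\sigma$ on $[n]$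 is the ideal of $E$ generated by all $e_S$ with $S\notin\sigma$; monomial ideals generated by such $e_S$ correspond bijectively to simplicial complexes on $[n]$. $\Delta_\varphi(\sigma)$ is the simplicial complex with $J_{\Delta_\varphi(\sigma)}=\mathrm{in}_{\prec_{rev}}(\varphi(J_\sigma))$, and the exterior algebraic shifting $\Delta(\sigma)$ is the simplicial complex with $J_{\Delta(\sigma)}=\mathrm{Gin}_{\prec_{rev}}(J_\sigma)$. For a simplicial complex $\tau$ and $S\subset[n]$, $m_{\preceq_{rev}S}(\tau)=|\{R\in\tau:\ |R|=|S|,\ R\preceq_{rev}S\}|$. -}

module Defs where

open import Level using (Level; _⊔_; suc)
open import Algebra.Bundles using (CommutativeRing)
open import Data.Nat as ℕ using (ℕ; _<ᵇ_; _≡ᵇ_; _≥_)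
open import Data.Fin using (Fin)
import Data.Fin as Fin
open import Data.Bool using (Bool; true; false; _∧_; _∨_; if_then_else_; T)
open import Data.Vec using (Vec; []; _∷_)
open import Data.List using (List; []; _∷_; _++_; map; filter; length; foldr)
open import Data.Product using (Σ; _×_; _,_; ∃)
open import Relation.Nullary using (¬_)
open import Relation.Binary.PropositionalEquality using (_≡_)
open import Relation.Nullary.Decidable using (T?)

record Field (c ℓ : Level) : Set (Level.suc (c ⊔ ℓ)) where
  field
    commutativeRing : CommutativeRing c ℓ
  open CommutativeRing commutativeRing public
  field
    1≉0     : ¬ (1# ≈ 0#)
    inverse : ∀ x → ¬ (x ≈ 0#) → Σ Carrier (λ y → (x * y) ≈ 1#)

Infinite : ∀ {c ℓ} → Field c ℓ → Set (c ⊔ ℓ)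
Infinite F = Σ (ℕ → Carrier) (λ f → ∀ i j → f i ≈ f j → i ≡ j)
  where open Field F

-- Subsets of [n] = {1,…,n}: a subset is a Vec Bool n, position 0
-- standing for the element 1, position k for the element k+1.

Subset : ℕ → Set
Subset n = Vec Bool n

allSubsets : (n : ℕ) → List (Subset n)
allSubsets ℕ.zero    = [] ∷ []
allSubsets (ℕ.suc n) = map (true ∷_) (allSubsets n) ++ map (false ∷_) (allSubsets n)

card : ∀ {n} → Subset n → ℕ
card []          = 0
card (true ∷ S)  = ℕ.suc (card S)
card (false ∷ S) = card S

elems : ∀ {n} → Subset n → List (Fin n)
elems []          = []
elems (true ∷ S)  = Fin.zero ∷ map Fin.suc (elems S)
elems (false ∷ S) = map Fin.suc (elems S)

_==_ : ∀ {n} → Subset n → Subset n → Bool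
[]      == []      = true
(a ∷ S) == (b ∷ R) = (if a then b else (if b then false else true)) ∧ (S == R)

disjointB : ∀ {n} → Subset n → Subset n → Bool
disjointB []      []      = true
disjointB (a ∷ S) (b ∷ R) = (if a then (if b then false else true) else true) ∧ disjointB S R

unionS : ∀ {n} → Subset n → Subset n → Subset n
unionS []      []      = []
unionS (a ∷ S) (b ∷ R) = (a ∨ b) ∷ unionS S R

inversions : ∀ {n} → Subset n → Subset n → ℕ
inversions []      []          = 0
inversions (a ∷ S) (true ∷ R)  = card S ℕ.+ inversions S R
inversions (a ∷ S) (false ∷ R) = inversions S R

singleton : ∀ {n} → Fin n → Subset n
singleton {ℕ.suc n} Fin.zero    = true ∷ Data.Vec.replicate n false
singleton {ℕ.suc n} (Fin.suc i) = false ∷ singleton i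

minSymDiffInFirst : ∀ {n} → Subset n → Subset n → Bool
minSymDiffInFirst []          []          = false
minSymDiffInFirst (true ∷ S)  (false ∷ R) = true
minSymDiffInFirst (false ∷ S) (true ∷ R)  = false
minSymDiffInFirst (true ∷ S)  (true ∷ R)  = minSymDiffInFirst S R
minSymDiffInFirst (false ∷ S) (false ∷ R) = minSymDiffInFirst S R

_≺rev_ : ∀ {n} → Subset n → Subset n → Bool
S ≺rev R = (card S <ᵇ card R) ∨ ((card S ≡ᵇ card R) ∧ minSymDiffInFirst S R)

_⪯rev_ : ∀ {n} → Subset n → Subset n → Bool
S ⪯rev R = (S == R) ∨ (S ≺rev R)

_⊆S_ : ∀ {n} → Subset n → Subset n → Set
S ⊆S R = T (unionS S R == R)

IsComplex : ∀ {n} → (Subset n → Bool) → Set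
IsComplex {n} σ = ∀ (R S : Subset n) → R ⊆S S → T (σ S) → T (σ R)

m⪯ : ∀ {n} → Subset n → (Subset n → Bool) → ℕ
m⪯ {n} S τ = length (filter (λ R → T? (τ R ∧ (card R ≡ᵇ card S) ∧ (R ⪯rev S))) (allSubsets n))

module Ext {c ℓ : Level} (F : Field c ℓ) where
  open Field F

  sumL : ∀ {A : Set} → List A → (A → Carrier) → Carrier
  sumL xs f = foldr (λ x acc → f x + acc) 0# xs

  sumFin : ∀ {n} → (Fin n → Carrier) → Carrier
  sumFin {ℕ.zero}  f = 0#
  sumFin {ℕ.suc n} f = f Fin.zero + sumFin (λ i → f (Fin.suc i))

  signPow : ℕ → Carrier
  signPow ℕ.zero    = 1#
  signPow (ℕ.suc k) = - (signPow k)

  -- An element of E = ⋀ K^n : its coefficient family (α_S)_S.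
  E : ℕ → Set c
  E n = Subset n → Carrier

  _≈E_ : ∀ {n} → E n → E n → Set ℓ
  f ≈E g = ∀ S → f S ≈ g S

  zeroE : ∀ {n} → E n
  zeroE S = 0#

  _+E_ : ∀ {n} → E n → E n → E n
  (f +E g) S = f S + g S

  mono : ∀ {n} → Subset n → E n
  mono S R = if S == R then 1# else 0#

  wedgeCoeff : ∀ {n} → Subset n → Subset n → Subset n → Carrier
  wedgeCoeff S R U = if disjointB S R ∧ (unionS S R == U) then signPow (inversions S R) else 0#

  _∧E_ : ∀ {n} → E n → E n → E n
  _∧E_ {n} f g U = sumL (allSubsets n) (λ S → sumL (allSubsets n) (λ R → (f S * g R) * wedgeCoeff S R U))

  Matrix : ℕ → Set c
  Matrix n = Fin n → Fin n → Carrier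

  _·M_ : ∀ {n} → Matrix n → Matrix n → Matrix n
  (A ·M B) i j = sumFin (λ k → A i k * B k j)

  idM : ∀ {n} → Matrix n
  idM i j = if Data.Bool.not (Data.Fin.toℕ i ≡ᵇ Data.Fin.toℕ j) then 0# else 1#

  _≈M_ : ∀ {n} → Matrix n → Matrix n → Set ℓ
  A ≈M B = ∀ i j → A i j ≈ B i j

  Invertible : ∀ {n} → Matrix n → Set (c ⊔ ℓ)
  Invertible {n} A = Σ (Matrix n) (λ B → ((A ·M B) ≈M idM) × ((B ·M A) ≈M idM))

  φlin : ∀ {n} → Matrix n → Fin n → E n
  φlin A j U = sumFin (λ i → A i j * mono (singleton i) U)

  φmono : ∀ {n} → Matrix n → Subset n → E n
  φmono {n} A S = foldr (λ j acc → φlin A j ∧E acc) (mono (Data.Vec.replicate n false)) (elems S)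

  act : ∀ {n} → Matrix n → E n → E n
  act {n} A f U = sumL (allSubsets n) (λ S → f S * φmono A S U)

  Ideal : ℕ → Set (Level.suc (c ⊔ ℓ))
  Ideal n = E n → Set (c ⊔ ℓ)

  data MonIdeal {n} (P : Subset n → Set (c ⊔ ℓ)) : E n → Set (c ⊔ ℓ) where
    izero : ∀ f → f ≈E zeroE → MonIdeal P f
    igen  : ∀ (a : E n) S → P S → ∀ f → f ≈E (a ∧E mono S) → MonIdeal P f
    iadd  : ∀ f g → MonIdeal P f → MonIdeal P g → ∀ h → h ≈E (f +E g) → MonIdeal P h

  faceIdeal : ∀ {n} → (Subset n → Bool) → Ideal n
  faceIdeal σ = MonIdeal (λ S → Level.Lift (c ⊔ ℓ) (σ S ≡ false))

  image : ∀ {n} → Matrix n → Ideal n → Ideal n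
  image A J g = Σ _ (λ f → J f × (g ≈E act A f))

  IsInitial : ∀ {n} → E n → Subset n → Set ℓ
  IsInitial {n} f S = ¬ (f S ≈ 0#) × (∀ (R : Subset n) → T (S ≺rev R) → f R ≈ 0#)

  initialIdeal : ∀ {n} → Ideal n → Ideal n
  initialIdeal J = MonIdeal (λ S → Σ _ (λ f → J f × Level.Lift c (IsInitial f S)))

  _≐_ : ∀ {n} → Ideal n → Ideal n → Set (c ⊔ ℓ)
  I ≐ J = ∀ f → (I f → J f) × (J f → I f)

  IsΔφ : ∀ {n} → Matrix n → (Subset n → Bool) → (Subset n → Bool) → Set (c ⊔ ℓ)
  IsΔφ A σ τ = IsComplex τ × (faceIdeal τ ≐ initialIdeal (image A (faceIdeal σ)))

  data Poly (V : Set) : Set c where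
    var   : V → Poly V
    const : Carrier → Poly V
    _⊕_   : Poly V → Poly V → Poly V
    _⊗_   : Poly V → Poly V → Poly V

  evalP : ∀ {V} → (V → Carrier) → Poly V → Carrier
  evalP ρ (var v)   = ρ v
  evalP ρ (const a) = a
  evalP ρ (p ⊕ q)   = evalP ρ p + evalP ρ q
  evalP ρ (p ⊗ q)   = evalP ρ p * evalP ρ q

  InOpen : ∀ {n} → Poly (Fin n × Fin n) → Matrix n → Set (c ⊔ ℓ)
  InOpen P A = Invertible A × ¬ (evalP (λ { (i , j) → A i j }) P ≈ 0#)

  -- τ = Δ(σ) : J_τ = Gin_{≺rev}(J_σ), i.e. J_τ = in_{≺rev}(φ(J_σ)) for
  -- all φ in a nonempty Zariski open subset of GL_n(K)
  IsΔ : ∀ {n} → (Subset n → Bool) → (Subset n → Bool) → Set (c ⊔ ℓ)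
  IsΔ {n} σ τ = IsComplex τ ×
    Σ (Poly (Fin n × Fin n)) (λ P →
      Σ (Matrix n) (InOpen P) ×
      (∀ (A : Matrix n) → InOpen P A → faceIdeal τ ≐ initialIdeal (image A (faceIdeal σ))))

{-# OPTIONS --safe #-}
-- For |S| = k the number of R ∉ Δ_φ(σ) with |R| = k and R ≻rev S is the rank
-- of φ(J_σ)_k modulo the monomials e_R, R ⪯rev S, and the number of all R ∉ Δ_φ(σ)
-- with |R| = k does not depend on φ.  So the claim is that a generic coordinate
-- change gives J_σ at least the rank it gives to in(φ(J_σ)).  With the weights
-- w(R) = Σ_{i ∈ R} 2^(n-i), R ≺rev S iff w(S) < w(R) for |R| = |S|, so in(φ(J_σ)) is the
-- limit for t → 0 of λ_t φ(J_σ), where λ_t = diag(t^(2^(n-1)), …, t^2, t).  Hence for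
-- B generic for in(φ(J_σ)) some B λ_t φ, t ≠ 0, gives J_σ at least the rank wanted,
-- and so do almost all points of the line from B λ_t φ to a matrix A that is
-- generic for σ, while almost all points of this line are generic for σ.
--
-- Equality in the field is not decidable, but the claim is; all case
-- distinctions on field elements are made under a double negation.
module Submission where

open import Defs
open import Level using (Level; _⊔_; lift)
open import Data.Nat as ℕ using (ℕ; zero; suc; _<ᵇ_; _≡ᵇ_; _≥_)
import Data.Nat.Properties as ℕ
open import Data.Nat.Induction using (<-rec)
open import Data.Fin as Fin using (Fin; zero; suc; punchIn)
import Data.Fin.Properties as Fin
open import Data.Bool using (Bool; true; false; _∧_; not; if_then_else_; T)
open import Data.Bool.Properties using (T-≡; T-∧; T-∨)
open import Data.Vec using ([]; _∷_; lookup; replicate)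
open import Data.Vec.Functional using (insertAt)
open import Data.Vec.Functional.Properties using (insertAt-lookup; insertAt-punchIn)
open import Data.List as List using (List; []; _∷_; _++_; map; filter; length; foldr; allFin)
open import Data.List.Properties using (map-id; map-∘; length-tabulate)
open import Data.List.Membership.Propositional using (_∈_)
open import Data.List.Membership.Propositional.Properties
  using (∈-++⁺ˡ; ∈-++⁺ʳ; ∈-map⁺; ∈-map⁻; ∈-filter⁺; ∈-filter⁻; ∈-lookup; ∈-allFin)
open import Data.List.Relation.Unary.Any using (here)
open import Data.List.Relation.Unary.All as All using (All; []; _∷_)
open import Data.List.Relation.Unary.AllPairs using ([]; _∷_)
open import Data.List.Relation.Unary.Unique.Propositional using (Unique)
import Data.List.Relation.Unary.Unique.Propositional.Properties as Unique
open import Data.Product using (Σ; _×_; _,_; ∃; proj₁; proj₂)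
open import Data.Sum using (_⊎_; inj₁; inj₂)
open import Data.Empty using (⊥; ⊥-elim)
open import Data.Unit using (tt)
open import Function using (_∘_; id; Equivalence)
open import Relation.Nullary using (¬_; yes; no)
open import Relation.Nullary.Negation using (¬¬-map)
open import Relation.Nullary.Decidable using (T?)
open import Relation.Binary using (tri<; tri≈; tri>)
open import Relation.Binary.PropositionalEquality as ≡ using (_≡_; _≢_; cong; subst)
open import Algebra.Properties.CommutativeSemigroup ℕ.+-commutativeSemigroup
  using () renaming (interchange to +-interchange)

-- The matrix λ_0 is singular, so the limit t → 0 cannot be taken on matrices. It is taken on
-- elements: each e_Q in an element of in(φ(J_σ)) is replaced by t^(-w(Q)) λ_t φ(h_Q), where h_Q ∈
-- J_σ has initial monomial e_Q after φ. Only exponents w(U) - w(Q) ≥ 0 survive, so the result is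
-- polynomial in t and makes sense at t = 0. The line towards A is there because nothing places B
-- λ_t φ in the open set on which the initial ideal of J_σ is known. Openness enters only along
-- one-parameter families: a polynomial in one variable that is nonzero somewhere is nonzero at
-- almost all terms of a sequence of distinct field elements, and finitely many such conditions have
-- a common solution. Rank is certified by independence of the rows of a square matrix of
-- coefficients.

false≢true : {b : Bool} → b ≡ true → b ≡ false → ⊥
false≢true ≡.refl ()

≡true : ∀ {b} → T b → b ≡ true
≡true = Equivalence.to T-≡

≡false : ∀ {b} → ¬ T b → b ≡ false
≡false {true}  ¬t = ⊥-elim (¬t tt)
≡false {false} ¬t = ≡.refl

≡true⇒T : ∀ {b} → b ≡ true → T b
≡true⇒T = Equivalence.from T-≡

T-∧-intro : ∀ {a b} → T a → T b → T (a ∧ b)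
T-∧-intro s t = Equivalence.from T-∧ (s , t)

==-refl : ∀ {n} (S : Subset n) → (S == S) ≡ true
==-refl []          = ≡.refl
==-refl (true ∷ S)  = ==-refl S
==-refl (false ∷ S) = ==-refl S

==-sound : ∀ {n} (S R : Subset n) → (S == R) ≡ true → S ≡ R
==-sound []          []          e = ≡.refl
==-sound (true ∷ S)  (true ∷ R)  e = cong (true ∷_) (==-sound S R e)
==-sound (false ∷ S) (false ∷ R) e = cong (false ∷_) (==-sound S R e)
==-sound (true ∷ S)  (false ∷ R) ()
==-sound (false ∷ S) (true ∷ R)  ()

∅ : ∀ {n} → Subset n
∅ = replicate _ false

-- Weights that encode the reverse lexicographic order

w : ∀ {n} → Subset n → ℕ
w []                = 0
w {suc n} (true ∷ S)  = 2 ℕ.^ n ℕ.+ w S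
w {suc n} (false ∷ S) = w S

-- All later bits together stay below the leading one, so the first difference decides a comparison
-- of weights. The counts below also use `2 ^ n` as a bound that every weight satisfies.
w<2^n : ∀ {n} (S : Subset n) → w S ℕ.< 2 ℕ.^ n
w<2^n []          = ℕ.s≤s ℕ.z≤n
w<2^n {suc n} (true ∷ S)  = ℕ.+-monoʳ-< (2 ℕ.^ n) (ℕ.<-≤-trans (w<2^n S) (ℕ.m≤m+n _ 0))
w<2^n {suc n} (false ∷ S) = ℕ.<-≤-trans (w<2^n S) (ℕ.m≤m+n _ _)

w-false<true : ∀ {n} (S R : Subset n) → w (false ∷ S) ℕ.< w (true ∷ R)
w-false<true S R = ℕ.<-≤-trans (w<2^n S) (ℕ.m≤m+n _ _)

w-injective : ∀ {n} (S R : Subset n) → w S ≡ w R → S ≡ R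
w-injective []          []          e = ≡.refl
w-injective (true ∷ S)  (true ∷ R)  e = cong (true ∷_) (w-injective S R (ℕ.+-cancelˡ-≡ _ _ _ e))
w-injective (false ∷ S) (false ∷ R) e = cong (false ∷_) (w-injective S R e)
w-injective (true ∷ S)  (false ∷ R) e = ⊥-elim (ℕ.<-irrefl (≡.sym e) (w-false<true R S))
w-injective (false ∷ S) (true ∷ R)  e = ⊥-elim (ℕ.<-irrefl e (w-false<true S R))

minSymDiff⇒w> : ∀ {n} (S R : Subset n) → T (minSymDiffInFirst S R) → w R ℕ.< w S
minSymDiff⇒w> []          []          ()
minSymDiff⇒w> (true ∷ S)  (false ∷ R) t = w-false<true R S
minSymDiff⇒w> (true ∷ S)  (true ∷ R)  t = ℕ.+-monoʳ-< _ (minSymDiff⇒w> S R t)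
minSymDiff⇒w> (false ∷ S) (false ∷ R) t = minSymDiff⇒w> S R t

w>⇒minSymDiff : ∀ {n} (S R : Subset n) → w R ℕ.< w S → T (minSymDiffInFirst S R)
w>⇒minSymDiff []          []          ()
w>⇒minSymDiff (true ∷ S)  (false ∷ R) p = tt
w>⇒minSymDiff (true ∷ S)  (true ∷ R)  p = w>⇒minSymDiff S R (ℕ.+-cancelˡ-< _ _ _ p)
w>⇒minSymDiff (false ∷ S) (false ∷ R) p = w>⇒minSymDiff S R p
w>⇒minSymDiff (false ∷ S) (true ∷ R)  p = ⊥-elim (ℕ.<-asym p (w-false<true S R))

≺rev⇒ : ∀ {n} (S R : Subset n) → T (S ≺rev R) →
        card S ℕ.< card R ⊎ (card S ≡ card R × w R ℕ.< w S)
≺rev⇒ S R t with Equivalence.to T-∨ t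
... | inj₁ p = inj₁ (ℕ.<ᵇ⇒< _ _ p)
... | inj₂ q with Equivalence.to T-∧ q
... | e , m = inj₂ (ℕ.≡ᵇ⇒≡ _ _ e , minSymDiff⇒w> S R m)

⇒≺rev : ∀ {n} (S R : Subset n) → card S ≡ card R → w R ℕ.< w S → T (S ≺rev R)
⇒≺rev S R e p = Equivalence.from (T-∨ {card S <ᵇ card R})
  (inj₂ (T-∧-intro (ℕ.≡⇒≡ᵇ _ _ e) (w>⇒minSymDiff S R p)))

-- On subsets of one size the order by `_≺rev_` is the reverse of the order by weight. The form of a
-- Boolean equation allows substitution inside a counting predicate.
⪯rev≡≥w : ∀ {n} (R S : Subset n) → card R ≡ card S → (R ⪯rev S) ≡ not (w R <ᵇ w S)
⪯rev≡≥w R S e with ℕ.<-cmp (w R) (w S)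
... | tri< lt ≢w ¬gt = ≡.trans (≡false ¬t) (cong not (≡.sym (≡true (ℕ.<⇒<ᵇ lt))))
  where
  ¬t : ¬ T (R ⪯rev S)
  ¬t t with Equivalence.to T-∨ t
  ... | inj₁ r=s = ≢w (cong w (==-sound R S (≡true r=s)))
  ... | inj₂ r≺s with ≺rev⇒ R S r≺s
  ...   | inj₁ c      = ℕ.<-irrefl e c
  ...   | inj₂ (_ , p) = ¬gt p
... | tri≈ ¬lt w= ¬gt = ≡.trans (≡true (Equivalence.from T-∨ (inj₁ (≡true⇒T r=s)))) (cong not (≡.sym (≡false (¬lt ∘ ℕ.<ᵇ⇒< _ _))))
  where
  r=s : (R == S) ≡ true
  r=s = subst (λ X → (R == X) ≡ true) (w-injective R S w=) (==-refl R)
... | tri> ¬lt _ gt = ≡.trans (≡true (Equivalence.from (T-∨ {R == S}) (inj₂ (⇒≺rev R S e gt)))) (cong not (≡.sym (≡false (¬lt ∘ ℕ.<ᵇ⇒< _ _))))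

-- U is the disjoint union of S and {j}. As an inductive relation it lets coefficients,
-- cardinalities and weights of S and U be compared by recursion on the position j.
data Ins : ∀ {n} → Fin n → Subset n → Subset n → Set where
  here  : ∀ {n} {S : Subset n} → Ins zero (false ∷ S) (true ∷ S)
  there : ∀ {n b} {j : Fin n} {S U} → Ins j S U → Ins (suc j) (b ∷ S) (b ∷ U)

∉⊎Ins : ∀ {n} (j : Fin n) (U : Subset n) → lookup U j ≡ false ⊎ ∃ λ S → Ins j S U
∉⊎Ins zero    (false ∷ U) = inj₁ ≡.refl
∉⊎Ins zero    (true ∷ U)  = inj₂ (_ , here)
∉⊎Ins (suc j) (b ∷ U) with ∉⊎Ins j U
... | inj₁ e       = inj₁ e
... | inj₂ (S , i) = inj₂ (b ∷ S , there i)

card-Ins : ∀ {n} {j : Fin n} {S U} → Ins j S U → card U ≡ suc (card S)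
card-Ins here                = ≡.refl
card-Ins (there {b = true} i)  = cong suc (card-Ins i)
card-Ins (there {b = false} i) = card-Ins i

bit : ∀ {n} → Fin n → ℕ
bit {suc n} zero    = 2 ℕ.^ n
bit {suc n} (suc j) = bit j

-- The increment depends on j alone, so inserting j into two subsets preserves their comparison by
-- weight.
w-Ins : ∀ {n} {j : Fin n} {S U} → Ins j S U → w U ≡ bit j ℕ.+ w S
w-Ins here = ≡.refl
w-Ins {suc n} (there {b = true} {j} {S} i) = ≡.trans (cong (2 ℕ.^ n ℕ.+_) (w-Ins i))
  (≡.trans (≡.sym (ℕ.+-assoc (2 ℕ.^ n) (bit j) (w S)))
    (≡.trans (cong (ℕ._+ w S) (ℕ.+-comm (2 ℕ.^ n) (bit j))) (ℕ.+-assoc (bit j) (2 ℕ.^ n) (w S))))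
w-Ins (there {b = false} i) = w-Ins i

-- R arises from S by single insertions. The predicate is generalized to `Q ∘ (b ∷_)` on the way
-- down, where an insertion into the tail is still an insertion into the whole subset.
upward-closed : ∀ {n a} (Q : Subset n → Set a) → (∀ {j S U} → Ins j S U → Q S → Q U) →
  ∀ S R → S ⊆S R → Q S → Q R
upward-closed Q step []          []          s q = q
upward-closed Q step (true ∷ S)  (true ∷ R)  s q = upward-closed (Q ∘ (true ∷_)) (step ∘ there) S R s q
upward-closed Q step (false ∷ S) (false ∷ R) s q = upward-closed (Q ∘ (false ∷_)) (step ∘ there) S R s q
upward-closed Q step (false ∷ S) (true ∷ R)  s q = upward-closed (Q ∘ (true ∷_)) (step ∘ there) S R s (step here q)
upward-closed Q step (true ∷ S)  (false ∷ R) () q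

⊆S-refl : ∀ {n} (S : Subset n) → S ⊆S S
⊆S-refl []          = tt
⊆S-refl (true ∷ S)  = ⊆S-refl S
⊆S-refl (false ∷ S) = ⊆S-refl S

-- Counting list entries

count : ∀ {A : Set} → (A → Bool) → List A → ℕ
count p xs = length (filter (λ x → T? (p x)) xs)

𝟙 : Bool → ℕ
𝟙 true  = 1
𝟙 false = 0

count-∷ : ∀ {A : Set} (p : A → Bool) x xs → count p (x ∷ xs) ≡ 𝟙 (p x) ℕ.+ count p xs
count-∷ p x xs with p x
... | true  = ≡.refl
... | false = ≡.refl

count-+ : ∀ {A : Set} (p q r s : A → Bool) →
  (∀ x → 𝟙 (p x) ℕ.+ 𝟙 (q x) ≡ 𝟙 (r x) ℕ.+ 𝟙 (s x)) →
  ∀ xs → count p xs ℕ.+ count q xs ≡ count r xs ℕ.+ count s xs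
count-+ p q r s h []       = ≡.refl
count-+ p q r s h (x ∷ xs) = begin
  count p (x ∷ xs) ℕ.+ count q (x ∷ xs)                       ≡⟨ ≡.cong₂ ℕ._+_ (count-∷ p x xs) (count-∷ q x xs) ⟩
  (𝟙 (p x) ℕ.+ count p xs) ℕ.+ (𝟙 (q x) ℕ.+ count q xs)       ≡⟨ +-interchange (𝟙 (p x)) _ _ _ ⟩
  (𝟙 (p x) ℕ.+ 𝟙 (q x)) ℕ.+ (count p xs ℕ.+ count q xs)       ≡⟨ ≡.cong₂ ℕ._+_ (h x) (count-+ p q r s h xs) ⟩
  (𝟙 (r x) ℕ.+ 𝟙 (s x)) ℕ.+ (count r xs ℕ.+ count s xs)       ≡⟨ +-interchange (𝟙 (r x)) _ _ _ ⟨
  (𝟙 (r x) ℕ.+ count r xs) ℕ.+ (𝟙 (s x) ℕ.+ count s xs)       ≡⟨ ≡.cong₂ ℕ._+_ (count-∷ r x xs) (count-∷ s x xs) ⟨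
  count r (x ∷ xs) ℕ.+ count s (x ∷ xs)                       ∎
  where open ≡.≡-Reasoning

-- Double negation as a monad

_>>=_ : ∀ {a b} {A : Set a} {B : Set b} → ¬ ¬ A → (A → ¬ ¬ B) → ¬ ¬ B
(m >>= f) k = m λ a → f a k

return : ∀ {a} {A : Set a} → A → ¬ ¬ A
return a k = k a

¬¬-em : ∀ {a} (A : Set a) → ¬ ¬ (A ⊎ ¬ A)
¬¬-em A k = k (inj₂ (k ∘ inj₁))

-- Double negation passes through this quantifier because the index type is finite: the proofs are
-- collected one index at a time.
¬¬-∀Fin : ∀ {a} n {P : Fin n → Set a} → (∀ i → ¬ ¬ P i) → ¬ ¬ (∀ i → P i)
¬¬-∀Fin zero    h = return λ ()
¬¬-∀Fin (suc n) h = do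
  p₀ ← h zero
  p  ← ¬¬-∀Fin n (h ∘ suc)
  return λ { zero → p₀ ; (suc i) → p i }

¬¬-∀Subset : ∀ {a} n {P : Subset n → Set a} → (∀ S → ¬ ¬ P S) → ¬ ¬ (∀ S → P S)
¬¬-∀Subset zero    h = do
  p ← h []
  return λ { [] → p }
¬¬-∀Subset (suc n) h = do
  p ← ¬¬-∀Subset n (h ∘ (true ∷_))
  q ← ¬¬-∀Subset n (h ∘ (false ∷_))
  return λ { (true ∷ S) → p S ; (false ∷ S) → q S }

-- Linear algebra over a field without decidable equality

module LinearAlgebra {c ℓ : Level} (F : Field c ℓ) where
  open Field F hiding (zero)
  open Ext F
  open import Algebra.Properties.Ring ring public using (-‿distribˡ-*; -‿distribʳ-*; -‿involutive; -0#≈0#; -‿+-comm)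
  open import Relation.Binary.Reasoning.Setoid setoid public
  open import Algebra.Solver.Ring.NaturalCoefficients.Default commutativeSemiring public
    using (solve; _:+_; _:*_; _:=_; con)

  a-a≈0 : ∀ {a b} → a ≈ b → a + - b ≈ 0#
  a-a≈0 {a} {b} e = trans (+-congʳ e) (-‿inverseʳ b)

  a-b≈0⇒a≈b : ∀ {a b} → a + - b ≈ 0# → a ≈ b
  a-b≈0⇒a≈b {a} {b} e = begin
    a               ≈⟨ +-identityʳ a ⟨
    a + 0#          ≈⟨ +-congˡ (-‿inverseˡ b) ⟨
    a + (- b + b)   ≈⟨ +-assoc a (- b) b ⟨
    (a + - b) + b   ≈⟨ +-congʳ e ⟩
    0# + b          ≈⟨ +-identityˡ b ⟩
    b               ∎

  -‿≉0 : ∀ {a} → ¬ (a ≈ 0#) → ¬ (- a ≈ 0#)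
  -‿≉0 a≉0 e = a≉0 (trans (sym (-‿involutive _)) (trans (-‿cong e) -0#≈0#))

  cancelʳ : ∀ {a b} → ¬ (b ≈ 0#) → a * b ≈ 0# → a ≈ 0#
  cancelʳ {a} {b} b≉0 e with inverse b b≉0
  ... | y , by≈1 = begin
    a             ≈⟨ *-identityʳ a ⟨
    a * 1#        ≈⟨ *-congˡ by≈1 ⟨
    a * (b * y)   ≈⟨ *-assoc a b y ⟨
    (a * b) * y   ≈⟨ *-congʳ e ⟩
    0# * y        ≈⟨ zeroˡ y ⟩
    0#            ∎

  *-≉0 : ∀ {a b} → ¬ (a ≈ 0#) → ¬ (b ≈ 0#) → ¬ (a * b ≈ 0#)
  *-≉0 a≉0 b≉0 e = a≉0 (cancelʳ b≉0 e)

  ≉0-factors : ∀ {a b} → ¬ (a * b ≈ 0#) → ¬ (a ≈ 0#) × ¬ (b ≈ 0#)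
  ≉0-factors ab≉0 = (λ e → ab≉0 (trans (*-congʳ e) (zeroˡ _))) , (λ e → ab≉0 (trans (*-congˡ e) (zeroʳ _)))

  -- Opaque, so that index type and summand can be inferred by unification.
  opaque
    ∑ : ∀ {n} → (Fin n → Carrier) → Carrier
    ∑ = sumFin

    ∑≡sumFin : ∀ {n} (f : Fin n → Carrier) → ∑ f ≡ sumFin f
    ∑≡sumFin f = ≡.refl

    ∑-empty : (f : Fin 0 → Carrier) → ∑ f ≈ 0#
    ∑-empty f = refl

    ∑-suc : ∀ {n} (f : Fin (suc n) → Carrier) → ∑ f ≈ f zero + ∑ (f ∘ suc)
    ∑-suc f = refl

  ∑-cong : ∀ {n} {f g : Fin n → Carrier} → (∀ i → f i ≈ g i) → ∑ f ≈ ∑ g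
  ∑-cong {zero}  h = trans (∑-empty _) (sym (∑-empty _))
  ∑-cong {suc n} h = trans (∑-suc _) (trans (+-cong (h zero) (∑-cong (h ∘ suc))) (sym (∑-suc _)))

  ∑-0 : ∀ {n} {f : Fin n → Carrier} → (∀ i → f i ≈ 0#) → ∑ f ≈ 0#
  ∑-0 {zero}  h = ∑-empty _
  ∑-0 {suc n} h = trans (∑-suc _) (trans (+-cong (h zero) (∑-0 (h ∘ suc))) (+-identityˡ 0#))

  +-interchange′ : ∀ a b c d → (a + b) + (c + d) ≈ (a + c) + (b + d)
  +-interchange′ = solve 4 (λ a b c d → ((a :+ b) :+ (c :+ d)) := ((a :+ c) :+ (b :+ d))) refl

  ∑-+ : ∀ {n} (f g : Fin n → Carrier) → ∑ (λ i → f i + g i) ≈ ∑ f + ∑ g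
  ∑-+ {zero}  f g = trans (∑-empty _) (sym (trans (+-cong (∑-empty f) (∑-empty g)) (+-identityˡ 0#)))
  ∑-+ {suc n} f g = begin
    ∑ (λ i → f i + g i)                                           ≈⟨ ∑-suc _ ⟩
    (f zero + g zero) + ∑ (λ i → f (suc i) + g (suc i))           ≈⟨ +-congˡ (∑-+ (f ∘ suc) (g ∘ suc)) ⟩
    (f zero + g zero) + (∑ (f ∘ suc) + ∑ (g ∘ suc))               ≈⟨ +-interchange′ _ _ _ _ ⟩
    (f zero + ∑ (f ∘ suc)) + (g zero + ∑ (g ∘ suc))               ≈⟨ +-cong (∑-suc f) (∑-suc g) ⟨
    ∑ f + ∑ g                                                     ∎

  *-∑ : ∀ {n} a (f : Fin n → Carrier) → a * ∑ f ≈ ∑ (λ i → a * f i)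
  *-∑ {zero}  a f = trans (*-congˡ (∑-empty f)) (trans (zeroʳ a) (sym (∑-empty _)))
  *-∑ {suc n} a f = begin
    a * ∑ f                                  ≈⟨ *-congˡ (∑-suc f) ⟩
    a * (f zero + ∑ (f ∘ suc))               ≈⟨ distribˡ a _ _ ⟩
    a * f zero + a * ∑ (f ∘ suc)             ≈⟨ +-congˡ (*-∑ a (f ∘ suc)) ⟩
    a * f zero + ∑ (λ i → a * f (suc i))     ≈⟨ ∑-suc _ ⟨
    ∑ (λ i → a * f i)                        ∎

  ∑-* : ∀ {n} (f : Fin n → Carrier) a → ∑ f * a ≈ ∑ (λ i → f i * a)
  ∑-* f a = trans (*-comm _ a) (trans (*-∑ a f) (∑-cong λ i → *-comm a (f i)))

  -x≈-1*x : ∀ x → - x ≈ - 1# * x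
  -x≈-1*x x = trans (-‿cong (sym (*-identityˡ x))) (-‿distribˡ-* 1# x)

  ∑-neg : ∀ {n} (f : Fin n → Carrier) → ∑ (λ i → - f i) ≈ - ∑ f
  ∑-neg f = trans (∑-cong λ i → -x≈-1*x (f i)) (trans (sym (*-∑ _ f)) (sym (-x≈-1*x _)))

  ∑-swap : ∀ {m n} (f : Fin m → Fin n → Carrier) → ∑ (λ i → ∑ (f i)) ≈ ∑ (λ j → ∑ (λ i → f i j))
  ∑-swap {zero}  f = trans (∑-empty _) (sym (∑-0 λ j → ∑-empty _))
  ∑-swap {suc m} f = begin
    ∑ (λ i → ∑ (f i))                                    ≈⟨ ∑-suc _ ⟩
    ∑ (f zero) + ∑ (λ i → ∑ (f (suc i)))                 ≈⟨ +-congˡ (∑-swap (f ∘ suc)) ⟩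
    ∑ (f zero) + ∑ (λ j → ∑ (λ i → f (suc i) j))         ≈⟨ ∑-+ _ _ ⟨
    ∑ (λ j → f zero j + ∑ (λ i → f (suc i) j))           ≈⟨ ∑-cong (λ j → ∑-suc _) ⟨
    ∑ (λ j → ∑ (λ i → f i j))                            ∎

  ∑-punchIn : ∀ {n} (i : Fin (suc n)) (f : Fin (suc n) → Carrier) → ∑ f ≈ f i + ∑ (f ∘ punchIn i)
  ∑-punchIn         zero    f = ∑-suc f
  ∑-punchIn {suc n} (suc i) f = begin
    ∑ f                                                        ≈⟨ ∑-suc f ⟩
    f zero + ∑ (f ∘ suc)                                       ≈⟨ +-congˡ (∑-punchIn i (f ∘ suc)) ⟩
    f zero + (f (suc i) + ∑ (f ∘ suc ∘ punchIn i))             ≈⟨ solve 3 (λ a b c → a :+ (b :+ c) := b :+ (a :+ c)) refl _ _ _ ⟩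
    f (suc i) + (f zero + ∑ (f ∘ suc ∘ punchIn i))             ≈⟨ +-congˡ (∑-suc _) ⟨
    f (suc i) + ∑ (f ∘ punchIn (suc i))                        ∎

  ∑-idM : ∀ {n} (j : Fin n) (f : Fin n → Carrier) → ∑ (λ i → f i * idM i j) ≈ f j
  ∑-idM zero    f = trans (∑-suc _) (trans (+-cong (*-identityʳ _) (∑-0 λ i → zeroʳ _)) (+-identityʳ _))
  ∑-idM (suc j) f = trans (∑-suc _) (trans (+-cong (zeroʳ _) (∑-idM j (f ∘ suc))) (+-identityˡ _))

  idM-sym : ∀ {n} (i j : Fin n) → idM i j ≈ idM j i
  idM-sym zero    zero    = refl
  idM-sym zero    (suc j) = refl
  idM-sym (suc i) zero    = refl
  idM-sym (suc i) (suc j) = idM-sym i j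

  -- Linear dependence and independence

  dependent : ∀ {A : Set} (xs : List A) {r} → length xs ℕ.< r → (v : Fin r → A → Carrier) →
    ¬ ¬ (Σ (Fin r → Carrier) λ a → (∃ λ i → ¬ (a i ≈ 0#)) ×
         All (λ x → ∑ (λ i → a i * v i x) ≈ 0#) xs)
  dependent []       {suc r} _ v = return ((λ _ → 1#) , (zero , 1≉0) , [])
  dependent (x ∷ xs) {suc r} (ℕ.s≤s l) v = do
    pivot ← ¬¬-em (∃ λ i → ¬ (v i x ≈ 0#))
    step pivot
    where
    step : (∃ λ i → ¬ (v i x ≈ 0#)) ⊎ ¬ (∃ λ i → ¬ (v i x ≈ 0#)) → _
    step (inj₂ none) = do
      vx≈0 ← ¬¬-∀Fin (suc r) (λ i e → none (i , e))
      (a , nz , h) ← dependent xs (ℕ.m<n⇒m<1+n l) v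
      return (a , nz , ∑-0 (λ i → trans (*-congˡ (vx≈0 i)) (zeroʳ _)) ∷ h)
    -- Gaussian elimination at the coordinate x: adding multiples of `v p` makes the other vectors
    -- vanish at x. A relation among the modified vectors becomes one among the original vectors
    -- once `v p` receives the accumulated coefficient.
    step (inj₁ (p , vpx≉0)) = do
      (a , (i , ai≉0) , h) ← dependent xs l v′
      return ( coef a
             , (punchIn p i , λ e → ai≉0 (trans (sym (reflexive (insertAt-punchIn a p _ i))) e))
             , trans (combine a x) (∑-0 (λ i → trans (*-congˡ (v′x≈0 i)) (zeroʳ _)))
               ∷ All.map (λ {z} → trans (combine a z)) h)
      where
      y = proj₁ (inverse (v p x) vpx≉0)
      ratio : Fin r → Carrier
      ratio i = - (v (punchIn p i) x * y)
      v′ : Fin r → _ → Carrier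
      v′ i z = v (punchIn p i) z + ratio i * v p z
      coef : (Fin r → Carrier) → Fin (suc r) → Carrier
      coef a = insertAt a p (∑ (λ i → a i * ratio i))
      v′x≈0 : ∀ i → v′ i x ≈ 0#
      v′x≈0 i = begin
        u + - (u * y) * q    ≈⟨ +-congˡ (sym (-‿distribˡ-* _ _)) ⟩
        u + - (u * y * q)    ≈⟨ a-a≈0 (begin
          u             ≈⟨ *-identityʳ u ⟨
          u * 1#        ≈⟨ *-congˡ (proj₂ (inverse q vpx≉0)) ⟨
          u * (q * y)   ≈⟨ solve 3 (λ u q y → u :* (q :* y) := u :* y :* q) refl u q y ⟩
          u * y * q     ∎) ⟩
        0#                   ∎
        where
        u = v (punchIn p i) x
        q = v p x
      combine : ∀ a z → ∑ (λ i → coef a i * v i z) ≈ ∑ (λ i → a i * v′ i z)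
      combine a z = begin
        ∑ (λ i → coef a i * v i z)
          ≈⟨ ∑-punchIn p _ ⟩
        coef a p * v p z + ∑ (λ i → coef a (punchIn p i) * v (punchIn p i) z)
          ≈⟨ +-cong (*-congʳ (reflexive (insertAt-lookup a p _)))
                    (∑-cong λ i → *-congʳ (reflexive (insertAt-punchIn a p _ i))) ⟩
        ∑ (λ i → a i * ratio i) * v p z + ∑ (λ i → a i * v (punchIn p i) z)
          ≈⟨ +-congʳ (∑-* _ _) ⟩
        ∑ (λ i → a i * ratio i * v p z) + ∑ (λ i → a i * v (punchIn p i) z)
          ≈⟨ ∑-+ _ _ ⟨
        ∑ (λ i → a i * ratio i * v p z + a i * v (punchIn p i) z)
          ≈⟨ ∑-cong (λ i → solve 4 (λ a r q u → a :* r :* q :+ a :* u := a :* (u :+ r :* q)) refl (a i) (ratio i) (v p z) (v (punchIn p i) z)) ⟩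
        ∑ (λ i → a i * v′ i z) ∎

  _·_ : ∀ {r} → Matrix r → Matrix r → Matrix r
  (M · N) i j = ∑ (λ k → M i k * N k j)

  ·≈·M : ∀ {r} (M N : Matrix r) → (M · N) ≈M (M ·M N)
  ·≈·M M N i j = reflexive (∑≡sumFin _)

  RowsIndependent : ∀ {r} → Matrix r → Set (c ⊔ ℓ)
  RowsIndependent {r} M = ∀ (a : Fin r → Carrier) → (∀ j → ∑ (λ i → a i * M i j) ≈ 0#) → ∀ i → a i ≈ 0#

  combination-· : ∀ {r} (a : Fin r → Carrier) (M N : Matrix r) j →
    ∑ (λ i → a i * (M · N) i j) ≈ ∑ (λ k → ∑ (λ i → a i * M i k) * N k j)
  combination-· a M N j = begin
    ∑ (λ i → a i * ∑ (λ k → M i k * N k j))     ≈⟨ ∑-cong (λ i → *-∑ (a i) _) ⟩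
    ∑ (λ i → ∑ (λ k → a i * (M i k * N k j)))   ≈⟨ ∑-swap _ ⟩
    ∑ (λ k → ∑ (λ i → a i * (M i k * N k j)))   ≈⟨ ∑-cong (λ k → ∑-cong λ i → sym (*-assoc (a i) _ _)) ⟩
    ∑ (λ k → ∑ (λ i → a i * M i k * N k j))     ≈⟨ ∑-cong (λ k → ∑-* _ (N k j)) ⟨
    ∑ (λ k → ∑ (λ i → a i * M i k) * N k j)     ∎

  rightInverse⇒RowsIndependent : ∀ {r} (M N : Matrix r) → (M · N) ≈M idM → RowsIndependent M
  rightInverse⇒RowsIndependent M N MN≈1 a aM≈0 j = begin
    a j                                                ≈⟨ ∑-idM j a ⟨
    ∑ (λ i → a i * idM i j)                       ≈⟨ ∑-cong (λ i → *-congˡ (MN≈1 i j)) ⟨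
    ∑ (λ i → a i * (M · N) i j)                  ≈⟨ combination-· a M N j ⟩
    ∑ (λ k → ∑ (λ i → a i * M i k) * N k j)  ≈⟨ ∑-0 (λ k → trans (*-congʳ (aM≈0 k)) (zeroˡ _)) ⟩
    0#                                                 ∎

  TwoSidedInverse : ∀ {r} → Matrix r → Set (c ⊔ ℓ)
  TwoSidedInverse {r} M = Σ (Matrix r) λ N → ((M · N) ≈M idM) × ((N · M) ≈M idM)

  -- The row `idM i` together with the r rows of M gives r + 1 vectors in r coordinates, hence a
  -- relation. Independence forbids that the coefficient of the added row is zero, so dividing by it
  -- expresses `idM i` through the rows of M, which is row i of a left inverse.
  RowsIndependent⇒Invertible : ∀ {r} (M : Matrix r) → RowsIndependent M → ¬ ¬ TwoSidedInverse M
  RowsIndependent⇒Invertible {r} M ind = do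
    rows ← ¬¬-∀Fin r row
    let N  = λ i → proj₁ (rows i)
        NM = λ i j → proj₂ (rows i) j
    return (N , MN≈1 N NM , NM)
    where
    Row : Fin r → Set (c ⊔ ℓ)
    Row i = Σ (Fin r → Carrier) λ b → ∀ j → ∑ (λ k → b k * M k j) ≈ idM i j
    solution : ∀ i (a₀ : Carrier) (a : Fin r → Carrier) → ¬ (a₀ ≈ 0#) →
      (∀ j → a₀ * idM i j + ∑ (λ k → a k * M k j) ≈ 0#) → Row i
    solution i a₀ a a₀≉0 h with inverse a₀ a₀≉0
    ... | y , a₀y≈1 = (λ k → - y * a k) , λ j → begin
      ∑ (λ k → - y * a k * M k j)     ≈⟨ ∑-cong (λ k → *-assoc (- y) (a k) _) ⟩
      ∑ (λ k → - y * (a k * M k j))   ≈⟨ *-∑ (- y) _ ⟨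
      - y * ∑ (λ k → a k * M k j)     ≈⟨ -‿distribˡ-* y _ ⟨
      - (y * ∑ (λ k → a k * M k j))   ≈⟨ a-b≈0⇒a≈b (begin
        - (y * ∑ (λ k → a k * M k j)) + - idM i j       ≈⟨ -‿+-comm _ _ ⟩
        - (y * ∑ (λ k → a k * M k j) + idM i j)         ≈⟨ -‿cong (begin
          y * ∑ (λ k → a k * M k j) + idM i j               ≈⟨ +-congˡ (*-identityˡ _) ⟨
          y * ∑ (λ k → a k * M k j) + 1# * idM i j          ≈⟨ +-congˡ (*-congʳ a₀y≈1) ⟨
          y * ∑ (λ k → a k * M k j) + a₀ * y * idM i j
            ≈⟨ solve 4 (λ y s a d → y :* s :+ a :* y :* d := y :* (a :* d :+ s)) refl y _ a₀ _ ⟩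
          y * (a₀ * idM i j + ∑ (λ k → a k * M k j))        ≈⟨ *-congˡ (h j) ⟩
          y * 0#                                                 ≈⟨ zeroʳ y ⟩
          0#                                                     ∎) ⟩
        - 0#                                                 ≈⟨ -0#≈0# ⟩
        0#                                                   ∎) ⟩
      idM i j                              ∎
    stack : Fin r → Fin (suc r) → Fin r → Carrier
    stack i zero    = idM i
    stack i (suc k) = M k
    nonzero-head : ∀ i (a : Fin (suc r) → Carrier) →
      (∀ j → ∑ (λ k → a k * stack i k j) ≈ 0#) → (∃ λ k → ¬ (a k ≈ 0#)) → ¬ (a zero ≈ 0#)
    nonzero-head i a h (k , ak≉0) a₀≈0 = ak≉0 (all≈0 k)
      where
      all≈0 : ∀ k → a k ≈ 0#
      all≈0 zero    = a₀≈0
      all≈0 (suc k) = ind (a ∘ suc) (λ j → begin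
        ∑ (λ k → a (suc k) * M k j)                     ≈⟨ +-identityˡ _ ⟨
        0# + ∑ (λ k → a (suc k) * M k j)                ≈⟨ +-congʳ (trans (*-congʳ a₀≈0) (zeroˡ _)) ⟨
        a zero * idM i j + ∑ (λ k → a (suc k) * M k j)  ≈⟨ ∑-suc _ ⟨
        ∑ (λ k → a k * stack i k j)                          ≈⟨ h j ⟩
        0#                                                   ∎) k
    row : ∀ i → ¬ ¬ Row i
    row i = do
      (a , nz , h) ← dependent (allFin r) (ℕ.≤-reflexive (cong suc (length-tabulate id))) (stack i)
      let h′ = λ j → All.lookup h (∈-allFin j)
      return (solution i (a zero) (a ∘ suc) (nonzero-head i a h′ nz) (λ j → trans (sym (∑-suc _)) (h′ j)))
    -- (MN - 1)M = M(NM) - M = 0, and independence of the rows of M cancels the factor M.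
    MN≈1 : ∀ N → (N · M) ≈M idM → (M · N) ≈M idM
    MN≈1 N NM≈1 p i = a-b≈0⇒a≈b (ind (λ i → (M · N) p i + - idM p i) (λ j → begin
      ∑ (λ i → ((M · N) p i + - idM p i) * M i j)
        ≈⟨ ∑-cong (λ i → trans (distribʳ _ _ _) (+-congˡ (sym (-‿distribˡ-* _ _)))) ⟩
      ∑ (λ i → (M · N) p i * M i j + - (idM p i * M i j))
        ≈⟨ ∑-+ _ _ ⟩
      ∑ (λ i → (M · N) p i * M i j) + ∑ (λ i → - (idM p i * M i j))
        ≈⟨ +-congˡ (∑-neg _) ⟩
      ∑ (λ i → (M · N) p i * M i j) + - ∑ (λ i → idM p i * M i j)
        ≈⟨ a-a≈0 (begin
          ∑ (λ i → (M · N) p i * M i j)   ≈⟨ combination-· (M p) N M j ⟨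
          ∑ (λ i → M p i * (N · M) i j)   ≈⟨ ∑-cong (λ i → *-congˡ (NM≈1 i j)) ⟩
          ∑ (λ i → M p i * idM i j)        ≈⟨ ∑-idM j (M p) ⟩
          M p j                                 ≈⟨ ∑-idM p (λ i → M i j) ⟨
          ∑ (λ i → M i j * idM i p)        ≈⟨ ∑-cong (λ i → trans (*-comm _ _) (*-congʳ (idM-sym i p))) ⟩
          ∑ (λ i → idM p i * M i j)        ∎) ⟩
      0# ∎) i)

  -- The Schur complement of the top left entry, multiplied by that entry: one step of fraction-free
  -- elimination.
  schur : ∀ {r} → Matrix (suc r) → Matrix r
  schur M i j = M zero zero * M (suc i) (suc j) + - (M (suc i) zero * M zero (suc j))

  -- A product of powers of the leading principal minors of M; no division, so it is polynomial in M.
  pivots : ∀ {r} → Matrix r → Carrier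
  pivots {zero}  M = 1#
  pivots {suc r} M = M zero zero * pivots (schur M)

  pivots-cong : ∀ {r} (M N : Matrix r) → M ≈M N → pivots M ≈ pivots N
  pivots-cong {zero}  M N e = refl
  pivots-cong {suc r} M N e = *-cong (e zero zero) (pivots-cong (schur M) (schur N) λ i j →
    +-cong (*-cong (e _ _) (e _ _)) (-‿cong (*-cong (e _ _) (e _ _))))

  pivots-idM : ∀ r → pivots (idM {r}) ≈ 1#
  pivots-idM zero    = refl
  pivots-idM (suc r) = trans (*-identityˡ _) (trans (pivots-cong {r} (schur idM) idM λ i j →
    trans (+-cong (*-identityˡ _) (trans (-‿cong (zeroˡ _)) -0#≈0#)) (+-identityʳ _)) (pivots-idM r))

  -- Column 0 expresses a₀ times the pivot through the tail of a, which turns the other columns into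
  -- a relation among the rows of the Schur complement. So the tail vanishes by induction, and then
  -- column 0 kills a₀. The converse fails, for instance for a transposition matrix.
  pivots⇒RowsIndependent : ∀ {r} (M : Matrix r) → ¬ (pivots M ≈ 0#) → RowsIndependent M
  pivots⇒RowsIndependent {suc r} M p≉0 a h = λ { zero → a₀≈0 ; (suc i) → tail≈0 i }
    where
    m₀₀≉0 = proj₁ (≉0-factors p≉0)
    m = M zero zero
    a₀ = a zero
    col : ∀ j → ∑ (λ i → a (suc i) * M (suc i) j) ≈ - (a₀ * M zero j)
    col j = a-b≈0⇒a≈b (trans (+-congˡ (-‿involutive _)) (trans (+-comm _ _) (trans (sym (∑-suc _)) (h j))))
    tail≈0 : ∀ i → a (suc i) ≈ 0#
    tail≈0 = pivots⇒RowsIndependent (schur M) (proj₂ (≉0-factors p≉0)) (a ∘ suc) λ j → begin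
      ∑ (λ i → a (suc i) * schur M i j)
        ≈⟨ ∑-cong (λ i → trans (distribˡ _ _ _) (+-cong
              (solve 3 (λ a b c → a :* (b :* c) := b :* (a :* c)) refl _ _ _)
              (trans (sym (-‿distribʳ-* _ _)) (-‿cong (sym (*-assoc _ _ _)))))) ⟩
      ∑ (λ i → m * (a (suc i) * M (suc i) (suc j)) + - (a (suc i) * M (suc i) zero * M zero (suc j)))
        ≈⟨ ∑-+ _ _ ⟩
      ∑ (λ i → m * (a (suc i) * M (suc i) (suc j))) + ∑ (λ i → - (a (suc i) * M (suc i) zero * M zero (suc j)))
        ≈⟨ +-cong (sym (*-∑ m _)) (trans (∑-neg _) (-‿cong (sym (∑-* _ _)))) ⟩
      m * ∑ (λ i → a (suc i) * M (suc i) (suc j)) + - (∑ (λ i → a (suc i) * M (suc i) zero) * M zero (suc j))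
        ≈⟨ a-a≈0 (begin
          m * ∑ (λ i → a (suc i) * M (suc i) (suc j))        ≈⟨ *-congˡ (col (suc j)) ⟩
          m * - (a₀ * M zero (suc j))                             ≈⟨ -‿distribʳ-* _ _ ⟨
          - (m * (a₀ * M zero (suc j)))                           ≈⟨ -‿cong (solve 3 (λ m a x → m :* (a :* x) := a :* m :* x) refl m a₀ _) ⟩
          - (a₀ * m * M zero (suc j))                             ≈⟨ -‿distribˡ-* _ _ ⟩
          - (a₀ * m) * M zero (suc j)                             ≈⟨ *-congʳ (col zero) ⟨
          ∑ (λ i → a (suc i) * M (suc i) zero) * M zero (suc j) ∎) ⟩
      0# ∎
    a₀≈0 : a₀ ≈ 0#
    a₀≈0 = cancelʳ m₀₀≉0 (begin
      a₀ * m                                                       ≈⟨ +-identityʳ _ ⟨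
      a₀ * m + 0#                                                  ≈⟨ +-congˡ (∑-0 λ i → trans (*-congʳ (tail≈0 i)) (zeroˡ _)) ⟨
      a₀ * m + ∑ (λ i → a (suc i) * M (suc i) zero)           ≈⟨ trans (sym (∑-suc _)) (h zero) ⟩
      0#                                                           ∎)

  -- Polynomial functions of one variable

  horner : List Carrier → Carrier → Carrier
  horner []      x = 0#
  horner (a ∷ p) x = a + x * horner p x

  -- A property of functions, so that sums, products, exterior powers of matrices and `pivots` can
  -- be shown polynomial in the form in which they occur.
  IsPoly : (Carrier → Carrier) → Set (c ⊔ ℓ)
  IsPoly g = ∃ λ p → ∀ x → g x ≈ horner p x

  IsPoly-cong : ∀ {f g} → (∀ x → f x ≈ g x) → IsPoly g → IsPoly f
  IsPoly-cong e (p , h) = p , λ x → trans (e x) (h x)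

  IsPoly-const : ∀ a → IsPoly (λ _ → a)
  IsPoly-const a = a ∷ [] , λ x → sym (trans (+-congˡ (zeroʳ x)) (+-identityʳ a))

  IsPoly-id : IsPoly (λ x → x)
  IsPoly-id = 0# ∷ 1# ∷ [] , λ x → sym (trans (+-identityˡ _)
    (trans (*-congˡ (trans (+-congˡ (zeroʳ x)) (+-identityʳ 1#))) (*-identityʳ x)))

  addP : List Carrier → List Carrier → List Carrier
  addP []      q       = q
  addP (a ∷ p) []      = a ∷ p
  addP (a ∷ p) (b ∷ q) = a + b ∷ addP p q

  horner-addP : ∀ p q x → horner (addP p q) x ≈ horner p x + horner q x
  horner-addP []      q       x = sym (+-identityˡ _)
  horner-addP (a ∷ p) []      x = sym (+-identityʳ _)
  horner-addP (a ∷ p) (b ∷ q) x = trans (+-congˡ (*-congˡ (horner-addP p q x)))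
    (solve 5 (λ a b x p q → a :+ b :+ x :* (p :+ q) := (a :+ x :* p) :+ (b :+ x :* q)) refl a b x _ _)

  horner-map-* : ∀ a p x → horner (map (a *_) p) x ≈ a * horner p x
  horner-map-* a []      x = sym (zeroʳ a)
  horner-map-* a (b ∷ p) x = trans (+-congˡ (*-congˡ (horner-map-* a p x)))
    (solve 4 (λ a b x p → a :* b :+ x :* (a :* p) := a :* (b :+ x :* p)) refl a b x _)

  mulP : List Carrier → List Carrier → List Carrier
  mulP []      q = []
  mulP (a ∷ p) q = addP (map (a *_) q) (0# ∷ mulP p q)

  horner-mulP : ∀ p q x → horner (mulP p q) x ≈ horner p x * horner q x
  horner-mulP []      q x = sym (zeroˡ _)
  horner-mulP (a ∷ p) q x = begin
    horner (mulP (a ∷ p) q) x                            ≈⟨ horner-addP (map (a *_) q) _ x ⟩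
    horner (map (a *_) q) x + (0# + x * horner (mulP p q) x)
      ≈⟨ +-cong (horner-map-* a q x) (trans (+-identityˡ _) (*-congˡ (horner-mulP p q x))) ⟩
    a * horner q x + x * (horner p x * horner q x)
      ≈⟨ solve 4 (λ a q x p → a :* q :+ x :* (p :* q) := (a :+ x :* p) :* q) refl a _ x _ ⟩
    (a + x * horner p x) * horner q x                    ∎

  IsPoly-+ : ∀ {f g} → IsPoly f → IsPoly g → IsPoly (λ x → f x + g x)
  IsPoly-+ (p , hp) (q , hq) = addP p q , λ x → trans (+-cong (hp x) (hq x)) (sym (horner-addP p q x))

  IsPoly-* : ∀ {f g} → IsPoly f → IsPoly g → IsPoly (λ x → f x * g x)
  IsPoly-* (p , hp) (q , hq) = mulP p q , λ x → trans (*-cong (hp x) (hq x)) (sym (horner-mulP p q x))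

  IsPoly-neg : ∀ {f} → IsPoly f → IsPoly (λ x → - f x)
  IsPoly-neg {f} hf with IsPoly-* (IsPoly-const (- 1#)) hf
  ... | p , hp = p , λ x → trans (trans (-‿cong (sym (*-identityˡ _))) (-‿distribˡ-* 1# _)) (hp x)

  IsPoly-∑ : ∀ {n} {f : Carrier → Fin n → Carrier} → (∀ i → IsPoly (λ x → f x i)) →
    IsPoly (λ x → ∑ (f x))
  IsPoly-∑ {zero}  h = IsPoly-cong (λ x → ∑-empty _) (IsPoly-const 0#)
  IsPoly-∑ {suc n} h = IsPoly-cong (λ x → ∑-suc _) (IsPoly-+ (h zero) (IsPoly-∑ (h ∘ suc)))

  IsPoly-sumL : ∀ {A : Set} (xs : List A) {f : Carrier → A → Carrier} → (∀ i → IsPoly (λ x → f x i)) →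
    IsPoly (λ x → sumL xs (f x))
  IsPoly-sumL []       h = IsPoly-const 0#
  IsPoly-sumL (a ∷ xs) h = IsPoly-+ (h a) (IsPoly-sumL xs h)

  IsPoly-pivots : ∀ {r} {M : Carrier → Matrix r} → (∀ i j → IsPoly (λ x → M x i j)) →
    IsPoly (λ x → pivots (M x))
  IsPoly-pivots {zero}  h = IsPoly-const 1#
  IsPoly-pivots {suc r} {M} h = IsPoly-* (h zero zero) (IsPoly-pivots {r} {λ x → schur (M x)} λ i j →
    IsPoly-+ (IsPoly-* (h _ _) (h _ _)) (IsPoly-neg (IsPoly-* (h _ _) (h _ _))))

  IsPoly-evalP : ∀ {V : Set} {ρ : Carrier → V → Carrier} → (∀ v → IsPoly (λ x → ρ x v)) →
    ∀ P → IsPoly (λ x → evalP (ρ x) P)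
  IsPoly-evalP h (var v)   = h v
  IsPoly-evalP h (const a) = IsPoly-const a
  IsPoly-evalP h (P ⊕ Q)   = IsPoly-+ (IsPoly-evalP h P) (IsPoly-evalP h Q)
  IsPoly-evalP h (P ⊗ Q)   = IsPoly-* (IsPoly-evalP h P) (IsPoly-evalP h Q)

  evalP-cong : ∀ {V : Set} {ρ ρ′ : V → Carrier} → (∀ v → ρ v ≈ ρ′ v) → ∀ P → evalP ρ P ≈ evalP ρ′ P
  evalP-cong h (var v)   = h v
  evalP-cong h (const a) = refl
  evalP-cong h (P ⊕ Q)   = +-cong (evalP-cong h P) (evalP-cong h Q)
  evalP-cong h (P ⊗ Q)   = *-cong (evalP-cong h P) (evalP-cong h Q)

  -- Synthetic division by x - z. For the polynomial `a ∷ p` the quotient is `quotient p z`; the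
  -- constant term a enters only the remainder.
  quotient : List Carrier → Carrier → List Carrier
  quotient []      z = []
  quotient (b ∷ p) z = horner (b ∷ p) z ∷ quotient p z

  length-quotient : ∀ p z → length (quotient p z) ≡ length p
  length-quotient []      z = ≡.refl
  length-quotient (b ∷ p) z = cong suc (length-quotient p z)

  horner-quotient : ∀ a p z x → horner (a ∷ p) x ≈ (x + - z) * horner (quotient p z) x + horner (a ∷ p) z
  horner-quotient a []      z x = begin
    a + x * 0#                       ≈⟨ +-congˡ (trans (zeroʳ x) (sym (zeroʳ z))) ⟩
    a + z * 0#                       ≈⟨ +-identityˡ _ ⟨
    0# + (a + z * 0#)                ≈⟨ +-congʳ (zeroʳ _) ⟨
    (x + - z) * 0# + (a + z * 0#)    ∎
  horner-quotient a (b ∷ p) z x = begin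
    a + x * horner (b ∷ p) x
      ≈⟨ +-congˡ (*-congˡ (horner-quotient b p z x)) ⟩
    a + x * ((x + - z) * q + h)
      ≈⟨ +-congˡ (*-congˡ (+-congˡ (*-identityʳ h))) ⟨
    a + x * ((x + - z) * q + h * 1#)
      ≈⟨ solve 6 (λ a x d q h u → a :+ x :* (d :* q :+ h :* u) := d :* (x :* q) :+ a :+ x :* (h :* u)) refl a x (x + - z) q h 1# ⟩
    (x + - z) * (x * q) + a + x * (h * 1#)
      ≈⟨ +-congˡ (trans (*-congˡ (*-identityʳ h)) (*-congʳ x≈)) ⟩
    (x + - z) * (x * q) + a + ((x + - z) + z) * h
      ≈⟨ solve 6 (λ a x d q h z → d :* (x :* q) :+ a :+ (d :+ z) :* h := d :* (h :+ x :* q) :+ (a :+ z :* h)) refl a x (x + - z) q h z ⟩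
    (x + - z) * (h + x * q) + (a + z * h) ∎
    where
    h = horner (b ∷ p) z
    q = horner (quotient p z) x
    x≈ : x ≈ (x + - z) + z
    x≈ = sym (trans (+-assoc x (- z) z) (trans (+-congˡ (-‿inverseˡ z)) (+-identityʳ x)))

  -- Nonvanishing at almost all points of an infinite field

  module Eventual (inf : Infinite F) where
    pt = proj₁ inf

    -- Cofiniteness along one fixed sequence of distinct elements. It stands in for nonempty Zariski
    -- open subsets of a line: finitely many such conditions can be intersected, and a common point
    -- can be exhibited.
    record Eventually {a} (Q : Carrier → Set a) : Set a where
      constructor after
      field
        bound : ℕ
        holds : ∀ i → bound ℕ.≤ i → Q (pt i)

    Eventually-∩ : ∀ {a b} {P : Carrier → Set a} {Q : Carrier → Set b} →
      Eventually P → Eventually Q → Eventually (λ x → P x × Q x)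
    Eventually-∩ (after m p) (after n q) = after (m ℕ.⊔ n) λ i le →
      p i (ℕ.≤-trans (ℕ.m≤m⊔n m n) le) , q i (ℕ.≤-trans (ℕ.m≤n⊔m m n) le)

    Eventually-map : ∀ {a b} {P : Carrier → Set a} {Q : Carrier → Set b} →
      (∀ x → P x → Q x) → Eventually P → Eventually Q
    Eventually-map h (after m p) = after m λ i le → h (pt i) (p i le)

    Eventually⇒∃ : ∀ {a} {P : Carrier → Set a} → Eventually P → ∃ P
    Eventually⇒∃ (after m p) = pt m , p m ℕ.≤-refl

    -- Whether some `pt i` is a root cannot be decided. Instead the negated conclusion `k` is used
    -- to show that none is: a root would split off a linear factor, the quotient is nonzero at x as
    -- well, and the induction hypothesis for it contradicts `k`. Without roots the bound 0 works.
    -- The recursion is on the length, because `quotient p z` is not a subterm.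
    horner-eventually≉0 : ∀ d p → length p ≡ d → ∀ x → ¬ (horner p x ≈ 0#) →
      ¬ ¬ Eventually (λ y → ¬ (horner p y ≈ 0#))
    horner-eventually≉0 d       []      len x nz = ⊥-elim (nz refl)
    horner-eventually≉0 (suc d) (a ∷ p) len x nz k = k (after 0 λ i _ → no-root i)
      where
      no-root : ∀ i → ¬ (horner (a ∷ p) (pt i) ≈ 0#)
      no-root i root = horner-eventually≉0 d (quotient p z) (≡.trans (length-quotient p z) (ℕ.suc-injective len)) x
          (λ e → nz (trans (factor x) (trans (*-congˡ e) (zeroʳ _))))
          -- The bound `m` serves the quotient; `suc i` keeps j beyond i, so that `pt j` differs
          -- from the root z = `pt i`.
          (λ { (after m q≉0) → k (after (m ℕ.⊔ suc i) λ j le e →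
            *-≉0 (λ e′ → ℕ.<-irrefl (proj₂ inf i j (sym (a-b≈0⇒a≈b e′))) (ℕ.≤-trans (ℕ.m≤n⊔m m (suc i)) le))
                 (q≉0 j (ℕ.≤-trans (ℕ.m≤m⊔n m (suc i)) le))
                 (trans (sym (factor (pt j))) e)) })
        where
        z = pt i
        factor : ∀ x → horner (a ∷ p) x ≈ (x + - z) * horner (quotient p z) x
        factor x = trans (horner-quotient a p z x) (trans (+-congˡ root) (+-identityʳ _))

    poly-eventually≉0 : ∀ {g} → IsPoly g → ∀ x → ¬ (g x ≈ 0#) → ¬ ¬ Eventually (λ y → ¬ (g y ≈ 0#))
    poly-eventually≉0 (p , h) x nz = do
      ev ← horner-eventually≉0 _ p ≡.refl x (λ e → nz (trans (h x) e))
      return (Eventually-map (λ y ne e → ne (trans (sym (h y)) e)) ev)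

    -- Independent rows of `M x` do not make `pivots (M x)` nonzero. Multiplying by the constant
    -- inverse N of `M x` normalizes the value at x to the identity matrix, where `pivots` is 1; so
    -- `pivots (N · M y)` is a polynomial in y that is nonzero at x.
    RowsIndependent-eventually : ∀ {r} (M : Carrier → Matrix r) → (∀ i j → IsPoly (λ x → M x i j)) →
      ∀ x → RowsIndependent (M x) → ¬ ¬ Eventually (λ y → RowsIndependent (M y))
    RowsIndependent-eventually {r} M poly x ind = do
      (N , MN , NM) ← RowsIndependent⇒Invertible (M x) ind
      ev ← poly-eventually≉0 (IsPoly-pivots {M = λ y → N · M y} λ i j → IsPoly-∑ λ k → IsPoly-* (IsPoly-const _) (poly k j)) x
             (λ e → 1≉0 (trans (sym (pivots-idM r)) (trans (pivots-cong {r} idM (N · M x) (λ i j → sym (NM i j))) e)))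
      return (Eventually-map (λ y ne → descend N MN NM y (pivots⇒RowsIndependent _ ne)) ev)
      where
      -- For b = a M(x) one has bN = a. Hence a M(y) = 0 says b N M(y) = 0, which gives b = 0 and so
      -- a = bN = 0.
      descend : ∀ N → (M x · N) ≈M idM → (N · M x) ≈M idM → ∀ y → RowsIndependent (N · M y) → RowsIndependent (M y)
      descend N MN NM y indN a h i = begin
        a i                                           ≈⟨ a≈bN i ⟨
        ∑ (λ k → b k * N k i)                    ≈⟨ ∑-0 (λ k → trans (*-congʳ (b≈0 k)) (zeroˡ _)) ⟩
        0#                                            ∎
        where
        b : Fin r → Carrier
        b k = ∑ (λ i → a i * M x i k)
        a≈bN : ∀ i → ∑ (λ k → b k * N k i) ≈ a i
        a≈bN i = begin
          ∑ (λ k → b k * N k i)               ≈⟨ combination-· a (M x) N i ⟨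
          ∑ (λ j → a j * (M x · N) j i)      ≈⟨ ∑-cong (λ j → *-congˡ (MN j i)) ⟩
          ∑ (λ j → a j * idM j i)             ≈⟨ ∑-idM i a ⟩
          a i                                      ∎
        b≈0 : ∀ k → b k ≈ 0#
        b≈0 = indN b (λ j → begin
          ∑ (λ k → b k * (N · M y) k j)                         ≈⟨ combination-· b N (M y) j ⟩
          ∑ (λ i → ∑ (λ k → b k * N k i) * M y i j)         ≈⟨ ∑-cong (λ i → *-congʳ (a≈bN i)) ⟩
          ∑ (λ i → a i * M y i j)                                ≈⟨ h j ⟩
          0#                                                          ∎)

-- Exterior algebra: multiplication by vectors and induced homomorphisms

module Exterior {c ℓ : Level} (F : Field c ℓ) where
  open Field F hiding (zero)
  open Ext F
  open LinearAlgebra F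

  sumL-cong : ∀ {A : Set} (xs : List A) {f g : A → Carrier} → (∀ x → f x ≈ g x) → sumL xs f ≈ sumL xs g
  sumL-cong []       h = refl
  sumL-cong (x ∷ xs) h = +-cong (h x) (sumL-cong xs h)

  sumL-++ : ∀ {A : Set} (xs ys : List A) (f : A → Carrier) → sumL (xs ++ ys) f ≈ sumL xs f + sumL ys f
  sumL-++ []       ys f = sym (+-identityˡ _)
  sumL-++ (x ∷ xs) ys f = trans (+-congˡ (sumL-++ xs ys f)) (sym (+-assoc _ _ _))

  sumL-map : ∀ {A B : Set} (h : A → B) xs (f : B → Carrier) → sumL (map h xs) f ≈ sumL xs (f ∘ h)
  sumL-map h []       f = refl
  sumL-map h (x ∷ xs) f = +-congˡ (sumL-map h xs f)

  opaque
    ∑S : ∀ {n} → (Subset n → Carrier) → Carrier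
    ∑S {n} = sumL (allSubsets n)

    ∑S≡sumL : ∀ {n} (f : Subset n → Carrier) → ∑S f ≡ sumL (allSubsets n) f
    ∑S≡sumL f = ≡.refl

    ∑S-[] : (f : Subset 0 → Carrier) → ∑S f ≈ f []
    ∑S-[] f = +-identityʳ (f [])

    ∑S-suc : ∀ {n} (f : Subset (suc n) → Carrier) → ∑S f ≈ ∑S (f ∘ (true ∷_)) + ∑S (f ∘ (false ∷_))
    ∑S-suc {n} f = trans (sumL-++ (map (true ∷_) (allSubsets n)) _ f)
      (+-cong (sumL-map (true ∷_) (allSubsets n) f) (sumL-map (false ∷_) (allSubsets n) f))

  ∑S-cong : ∀ {n} {f g : Subset n → Carrier} → (∀ S → f S ≈ g S) → ∑S f ≈ ∑S g
  ∑S-cong {zero}  h = trans (∑S-[] _) (trans (h []) (sym (∑S-[] _)))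
  ∑S-cong {suc n} h = trans (∑S-suc _) (trans (+-cong (∑S-cong (h ∘ (true ∷_))) (∑S-cong (h ∘ (false ∷_)))) (sym (∑S-suc _)))

  ∑S-0 : ∀ {n} {f : Subset n → Carrier} → (∀ S → f S ≈ 0#) → ∑S f ≈ 0#
  ∑S-0 {zero}  h = trans (∑S-[] _) (h [])
  ∑S-0 {suc n} h = trans (∑S-suc _) (trans (+-cong (∑S-0 (h ∘ (true ∷_))) (∑S-0 (h ∘ (false ∷_)))) (+-identityˡ 0#))

  ∑S-+ : ∀ {n} (f g : Subset n → Carrier) → ∑S (λ S → f S + g S) ≈ ∑S f + ∑S g
  ∑S-+ {zero}  f g = trans (∑S-[] _) (sym (+-cong (∑S-[] f) (∑S-[] g)))
  ∑S-+ {suc n} f g = begin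
    ∑S (λ S → f S + g S)
      ≈⟨ ∑S-suc _ ⟩
    ∑S (λ S → f (true ∷ S) + g (true ∷ S)) + ∑S (λ S → f (false ∷ S) + g (false ∷ S))
      ≈⟨ +-cong (∑S-+ (f ∘ (true ∷_)) _) (∑S-+ (f ∘ (false ∷_)) _) ⟩
    (∑S (f ∘ (true ∷_)) + ∑S (g ∘ (true ∷_))) + (∑S (f ∘ (false ∷_)) + ∑S (g ∘ (false ∷_)))
      ≈⟨ +-interchange′ _ _ _ _ ⟩
    (∑S (f ∘ (true ∷_)) + ∑S (f ∘ (false ∷_))) + (∑S (g ∘ (true ∷_)) + ∑S (g ∘ (false ∷_)))
      ≈⟨ +-cong (∑S-suc f) (∑S-suc g) ⟨
    ∑S f + ∑S g ∎

  *-∑S : ∀ {n} a (f : Subset n → Carrier) → a * ∑S f ≈ ∑S (λ S → a * f S)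
  *-∑S {zero}  a f = trans (*-congˡ (∑S-[] f)) (sym (∑S-[] _))
  *-∑S {suc n} a f = begin
    a * ∑S f                                                     ≈⟨ *-congˡ (∑S-suc f) ⟩
    a * (∑S (f ∘ (true ∷_)) + ∑S (f ∘ (false ∷_)))               ≈⟨ distribˡ a _ _ ⟩
    a * ∑S (f ∘ (true ∷_)) + a * ∑S (f ∘ (false ∷_))             ≈⟨ +-cong (*-∑S a _) (*-∑S a _) ⟩
    ∑S (λ S → a * f (true ∷ S)) + ∑S (λ S → a * f (false ∷ S))   ≈⟨ ∑S-suc _ ⟨
    ∑S (λ S → a * f S)                                           ∎

  ∑S-∑ : ∀ {k n} (f : Fin k → Subset n → Carrier) → ∑S (λ S → ∑ (λ i → f i S)) ≈ ∑ (λ i → ∑S (f i))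
  ∑S-∑ {zero}  f = trans (∑S-0 λ S → ∑-empty _) (sym (∑-empty _))
  ∑S-∑ {suc k} f = begin
    ∑S (λ S → ∑ (λ i → f i S))                       ≈⟨ ∑S-cong (λ S → ∑-suc _) ⟩
    ∑S (λ S → f zero S + ∑ (λ i → f (suc i) S))      ≈⟨ ∑S-+ _ _ ⟩
    ∑S (f zero) + ∑S (λ S → ∑ (λ i → f (suc i) S))   ≈⟨ +-congˡ (∑S-∑ (f ∘ suc)) ⟩
    ∑S (f zero) + ∑ (λ i → ∑S (f (suc i)))           ≈⟨ ∑-suc _ ⟨
    ∑ (λ i → ∑S (f i))                               ∎

  ∑S-mono : ∀ {n} (U : Subset n) (f : Subset n → Carrier) → ∑S (λ S → f S * mono U S) ≈ f U
  ∑S-mono []          f = trans (∑S-[] _) (*-identityʳ _)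
  ∑S-mono (true ∷ U)  f = trans (∑S-suc _) (trans (+-cong (∑S-mono U (f ∘ (true ∷_))) (∑S-0 λ S → zeroʳ _)) (+-identityʳ _))
  ∑S-mono (false ∷ U) f = trans (∑S-suc _) (trans (+-cong (∑S-0 λ S → zeroʳ _) (∑S-mono U (f ∘ (false ∷_)))) (+-identityˡ _))

  mono-sym : ∀ {n} (S R : Subset n) → mono S R ≈ mono R S
  mono-sym []          []          = refl
  mono-sym (true ∷ S)  (true ∷ R)  = mono-sym S R
  mono-sym (true ∷ S)  (false ∷ R) = refl
  mono-sym (false ∷ S) (true ∷ R)  = refl
  mono-sym (false ∷ S) (false ∷ R) = mono-sym S R

  mono-diag : ∀ {n} (S : Subset n) → mono S S ≈ 1#
  mono-diag S rewrite ==-refl S = refl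

  mono-≢ : ∀ {n} {S R : Subset n} → S ≢ R → mono S R ≈ 0#
  mono-≢ {S = S} {R} S≢R with S == R in e
  ... | true  = ⊥-elim (S≢R (==-sound S R e))
  ... | false = refl

  card-∅ : ∀ n → card (∅ {n}) ≡ 0
  card-∅ zero    = ≡.refl
  card-∅ (suc n) = card-∅ n

  record Linear {m n} (Φ : E m → E n) : Set (c ⊔ ℓ) where
    field
      ≈-cong  : ∀ {f g} → (∀ S → f S ≈ g S) → ∀ U → Φ f U ≈ Φ g U
      +-homo  : ∀ f g U → Φ (λ S → f S + g S) U ≈ Φ f U + Φ g U
      *-homo  : ∀ a f U → Φ (λ S → a * f S) U ≈ a * Φ f U

    0-homo : ∀ {f} → (∀ S → f S ≈ 0#) → ∀ U → Φ f U ≈ 0#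
    0-homo {f} h U = begin
      Φ f U                     ≈⟨ ≈-cong (λ S → trans (h S) (sym (zeroˡ _))) U ⟩
      Φ (λ S → 0# * f S) U      ≈⟨ *-homo 0# f U ⟩
      0# * Φ f U                ≈⟨ zeroˡ _ ⟩
      0#                        ∎

    neg-homo : ∀ f U → Φ (λ S → - f S) U ≈ - Φ f U
    neg-homo f U = trans (≈-cong (λ S → -x≈-1*x (f S)) U) (trans (*-homo (- 1#) f U) (sym (-x≈-1*x _)))

    ∑-homo : ∀ {k} (f : Fin k → E m) U → Φ (λ S → ∑ (λ i → f i S)) U ≈ ∑ (λ i → Φ (f i) U)
    ∑-homo {zero}  f U = trans (0-homo (λ S → ∑-empty _) U) (sym (∑-empty _))
    ∑-homo {suc k} f U = begin
      Φ (λ S → ∑ (λ i → f i S)) U                           ≈⟨ ≈-cong (λ S → ∑-suc _) U ⟩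
      Φ (λ S → f zero S + ∑ (λ i → f (suc i) S)) U          ≈⟨ +-homo _ _ U ⟩
      Φ (f zero) U + Φ (λ S → ∑ (λ i → f (suc i) S)) U      ≈⟨ +-congˡ (∑-homo (f ∘ suc) U) ⟩
      Φ (f zero) U + ∑ (λ i → Φ (f (suc i)) U)              ≈⟨ ∑-suc _ ⟨
      ∑ (λ i → Φ (f i) U)                                   ∎

    linear-combination : ∀ {k} (a : Fin k → Carrier) (f : Fin k → E m) U →
      Φ (λ S → ∑ (λ i → a i * f i S)) U ≈ ∑ (λ i → a i * Φ (f i) U)
    linear-combination a f U = trans (∑-homo (λ i S → a i * f i S) U) (∑-cong λ i → *-homo (a i) (f i) U)

    ∑S-homo : ∀ {k} (f : Subset k → E m) U → Φ (λ S → ∑S (λ R → f R S)) U ≈ ∑S (λ R → Φ (f R) U)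
    ∑S-homo {zero}  f U = trans (≈-cong (λ S → ∑S-[] _) U) (sym (∑S-[] _))
    ∑S-homo {suc k} f U = begin
      Φ (λ S → ∑S (λ R → f R S)) U
        ≈⟨ ≈-cong (λ S → ∑S-suc _) U ⟩
      Φ (λ S → ∑S (λ R → f (true ∷ R) S) + ∑S (λ R → f (false ∷ R) S)) U
        ≈⟨ +-homo _ _ U ⟩
      Φ (λ S → ∑S (λ R → f (true ∷ R) S)) U + Φ (λ S → ∑S (λ R → f (false ∷ R) S)) U
        ≈⟨ +-cong (∑S-homo (f ∘ (true ∷_)) U) (∑S-homo (f ∘ (false ∷_)) U) ⟩
      ∑S (λ R → Φ (f (true ∷ R)) U) + ∑S (λ R → Φ (f (false ∷ R)) U)
        ≈⟨ ∑S-suc _ ⟨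
      ∑S (λ R → Φ (f R) U) ∎

  open Linear

  -- L v x = v ∧ x for a vector v of degree one, computed along the
  -- decomposition x = x₀ + e₁ ∧ x₁.
  L : ∀ {n} → (Fin n → Carrier) → E n → E n
  L v x []          = 0#
  L v x (false ∷ U) = L (v ∘ suc) (x ∘ (false ∷_)) U
  L v x (true ∷ U)  = v zero * x (false ∷ U) + - L (v ∘ suc) (x ∘ (true ∷_)) U

  x+-0 : ∀ {a b} → b ≈ 0# → a + - b ≈ a
  x+-0 b≈0 = trans (+-congˡ (trans (-‿cong b≈0) -0#≈0#)) (+-identityʳ _)

  L-cong₂ : ∀ {n} {v u : Fin n → Carrier} {x y : E n} → (∀ i → v i ≈ u i) → (∀ S → x S ≈ y S) → ∀ U → L v x U ≈ L u y U
  L-cong₂ h k []          = refl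
  L-cong₂ h k (false ∷ U) = L-cong₂ (h ∘ suc) (k ∘ (false ∷_)) U
  L-cong₂ h k (true ∷ U)  = +-cong (*-cong (h zero) (k _)) (-‿cong (L-cong₂ (h ∘ suc) (k ∘ (true ∷_)) U))

  L-cong : ∀ {n} (v : Fin n → Carrier) {x y : E n} → (∀ S → x S ≈ y S) → ∀ U → L v x U ≈ L v y U
  L-cong v = L-cong₂ (λ _ → refl)

  neg-+ : ∀ a b → - (a + b) ≈ - a + - b
  neg-+ a b = sym (-‿+-comm a b)

  L-+ : ∀ {n} (v : Fin n → Carrier) (x y : E n) U → L v (λ S → x S + y S) U ≈ L v x U + L v y U
  L-+ v x y []          = sym (+-identityˡ 0#)
  L-+ v x y (false ∷ U) = L-+ (v ∘ suc) _ _ U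
  L-+ v x y (true ∷ U)  = trans
    (+-cong (distribˡ _ _ _) (trans (-‿cong (L-+ (v ∘ suc) _ _ U)) (neg-+ _ _)))
    (+-interchange′ _ _ _ _)

  L-* : ∀ {n} (v : Fin n → Carrier) a (x : E n) U → L v (λ S → a * x S) U ≈ a * L v x U
  L-* v a x []          = sym (zeroʳ a)
  L-* v a x (false ∷ U) = L-* (v ∘ suc) a _ U
  L-* v a x (true ∷ U)  = trans
    (+-cong (solve 3 (λ v a x → v :* (a :* x) := a :* (v :* x)) refl _ _ _)
            (trans (-‿cong (L-* (v ∘ suc) a _ U)) (-‿distribʳ-* a _)))
    (sym (distribˡ a _ _))

  L-linear : ∀ {n} (v : Fin n → Carrier) → Linear (L v)
  L-linear v = record { ≈-cong = L-cong v ; +-homo = L-+ v ; *-homo = L-* v }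

  L-0ᵥ : ∀ {n} {v : Fin n → Carrier} → (∀ i → v i ≈ 0#) → ∀ x U → L v x U ≈ 0#
  L-0ᵥ h x []          = refl
  L-0ᵥ h x (false ∷ U) = L-0ᵥ (h ∘ suc) _ U
  L-0ᵥ h x (true ∷ U)  = trans (x+-0 (L-0ᵥ (h ∘ suc) _ U)) (trans (*-congʳ (h zero)) (zeroˡ _))

  L-*+ᵥ : ∀ {n} a (v u : Fin n → Carrier) x U → L (λ j → a * v j + u j) x U ≈ a * L v x U + L u x U
  L-*+ᵥ a v u x []          = sym (trans (+-identityʳ _) (zeroʳ a))
  L-*+ᵥ a v u x (false ∷ U) = L-*+ᵥ a (v ∘ suc) (u ∘ suc) _ U
  L-*+ᵥ a v u x (true ∷ U)  = trans
    (+-cong (trans (distribʳ _ _ _) (+-congʳ (*-assoc _ _ _)))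
            (trans (-‿cong (L-*+ᵥ a (v ∘ suc) (u ∘ suc) _ U)) (trans (neg-+ _ _) (+-congʳ (-‿distribʳ-* a _)))))
    (trans (+-interchange′ _ _ _ _) (+-congʳ (sym (distribˡ a _ _))))

  -- Coefficients without e₁ reduce to the tails of v, u and x, so this one carries the content.
  -- Both v ∧ v = 0 and anticommutativity are read off from it.
  L-expand : ∀ {n} (v u : Fin (suc n) → Carrier) (x : E (suc n)) U →
    L v (L u x) (true ∷ U) ≈
    v zero * L (u ∘ suc) (x ∘ (false ∷_)) U +
      - (u zero * L (v ∘ suc) (x ∘ (false ∷_)) U + - L (v ∘ suc) (L (u ∘ suc) (x ∘ (true ∷_))) U)
  L-expand v u x U = +-congˡ (-‿cong (trans (L-+ (v ∘ suc) _ _ U)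
    (+-cong (L-* (v ∘ suc) (u zero) _ U) (neg-homo (L-linear (v ∘ suc)) _ U))))

  -- Proved by itself, since in characteristic 2 it does not follow from `L-anticomm`.
  L-square : ∀ {n} (v : Fin n → Carrier) x U → L v (L v x) U ≈ 0#
  L-square v x []          = refl
  L-square v x (false ∷ U) = L-square (v ∘ suc) _ U
  L-square v x (true ∷ U)  = trans (L-expand v v x U) (a-a≈0 (sym (x+-0 (L-square (v ∘ suc) _ U))))

  L-anticomm : ∀ {n} (v u : Fin n → Carrier) x U → L v (L u x) U ≈ - L u (L v x) U
  L-anticomm v u x []          = sym -0#≈0#
  L-anticomm v u x (false ∷ U) = L-anticomm (v ∘ suc) (u ∘ suc) _ U
  L-anticomm v u x (true ∷ U)  = begin
    L v (L u x) (true ∷ U)         ≈⟨ L-expand v u x U ⟩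
    p + - (q + - r)                ≈⟨ +-congˡ (trans (neg-+ q (- r)) (+-congˡ (-‿involutive r))) ⟩
    p + (- q + r)                  ≈⟨ +-congˡ (+-congˡ (L-anticomm (v ∘ suc) (u ∘ suc) _ U)) ⟩
    p + (- q + - s)                ≈⟨ solve 3 (λ p q s → p :+ (q :+ s) := q :+ (p :+ s)) refl p (- q) (- s) ⟩
    - q + (p + - s)                ≈⟨ +-congˡ (-‿involutive _) ⟨
    - q + - - (p + - s)            ≈⟨ neg-+ q _ ⟨
    - (q + - (p + - s))            ≈⟨ -‿cong (L-expand u v x U) ⟨
    - L u (L v x) (true ∷ U)       ∎
    where
    p = v zero * L (u ∘ suc) (x ∘ (false ∷_)) U
    q = u zero * L (v ∘ suc) (x ∘ (false ∷_)) U
    r = L (v ∘ suc) (L (u ∘ suc) (x ∘ (true ∷_))) U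
    s = L (u ∘ suc) (L (v ∘ suc) (x ∘ (true ∷_))) U

  L-degree : ∀ {n} (v : Fin n → Carrier) {x y : E n} U →
    (∀ S → suc (card S) ≡ card U → x S ≈ y S) → L v x U ≈ L v y U
  L-degree v []          h = refl
  L-degree v (false ∷ U) h = L-degree (v ∘ suc) U (h ∘ (false ∷_))
  L-degree v (true ∷ U)  h = +-cong (*-congˡ (h (false ∷ U) ≡.refl))
    (-‿cong (L-degree (v ∘ suc) U λ S e → h (true ∷ S) (cong suc e)))

  -- The coefficient of v ∧ x at U involves x only at subsets of U. This is why multiplication by v
  -- preserves the ideal of a complex.
  L-vanishes-below : ∀ {n} (v : Fin n → Carrier) {x : E n} U → (∀ S → S ⊆S U → x S ≈ 0#) → L v x U ≈ 0#
  L-vanishes-below v []          h = refl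
  L-vanishes-below v (false ∷ U) h = L-vanishes-below (v ∘ suc) U (h ∘ (false ∷_))
  L-vanishes-below v (true ∷ U)  h = trans (x+-0 (L-vanishes-below (v ∘ suc) U (h ∘ (true ∷_))))
    (trans (*-congˡ (h (false ∷ U) (⊆S-refl U))) (zeroʳ _))

  basisVector : ∀ {n} → Fin n → Fin n → Carrier
  basisVector j i = idM i j

  -- The sign counts the elements of S before j. It is left open, since the applications ask only
  -- whether a coefficient vanishes.
  L-basis-Ins : ∀ {n} {j : Fin n} {S U} → Ins j S U → (x : E n) →
    L (basisVector j) x U ≈ x S ⊎ L (basisVector j) x U ≈ - x S
  L-basis-Ins (here {S = S}) x = inj₁ (trans (x+-0 (L-0ᵥ (λ _ → refl) _ S)) (*-identityˡ _))
  L-basis-Ins (there {b = false} i) x = L-basis-Ins i (x ∘ (false ∷_))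
  L-basis-Ins (there {b = true} {j} {S} {U} i) x with L-basis-Ins i (x ∘ (true ∷_))
  ... | inj₁ e = inj₂ (trans (+-congʳ (zeroˡ _)) (trans (+-identityˡ _) (-‿cong e)))
  ... | inj₂ e = inj₁ (trans (+-congʳ (zeroˡ _)) (trans (+-identityˡ _) (trans (-‿cong e) (-‿involutive _))))

  L-basis-∉ : ∀ {n} (j : Fin n) U → lookup U j ≡ false → ∀ x → L (basisVector j) x U ≈ 0#
  L-basis-∉ zero    (false ∷ U) e x = L-0ᵥ (λ _ → refl) _ U
  L-basis-∉ (suc j) (false ∷ U) e x = L-basis-∉ j U e _
  L-basis-∉ (suc j) (true ∷ U)  e x = trans (x+-0 (L-basis-∉ j U e _)) (zeroˡ _)

  -- Λ a is the algebra homomorphism sending e_i to the vector a i.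
  Λ : ∀ {m n} → (Fin m → Fin n → Carrier) → E m → E n
  Λ {zero}  a f U = f [] * mono ∅ U
  Λ {suc m} a f U = Λ (a ∘ suc) (f ∘ (false ∷_)) U + L (a zero) (Λ (a ∘ suc) (f ∘ (true ∷_))) U

  Λ-cong₂ : ∀ {m n} {a b : Fin m → Fin n → Carrier} {f g : E m} →
    (∀ i j → a i j ≈ b i j) → (∀ S → f S ≈ g S) → ∀ U → Λ a f U ≈ Λ b g U
  Λ-cong₂ {zero}  h k U = *-congʳ (k [])
  Λ-cong₂ {suc m} h k U = +-cong (Λ-cong₂ (h ∘ suc) (k ∘ (false ∷_)) U)
    (L-cong₂ (h zero) (Λ-cong₂ (h ∘ suc) (k ∘ (true ∷_))) U)

  Λ-linear : ∀ {m n} (a : Fin m → Fin n → Carrier) → Linear (Λ a)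
  Λ-linear {zero} a = record
    { ≈-cong = λ h U → *-congʳ (h [])
    ; +-homo = λ f g U → distribʳ _ _ _
    ; *-homo = λ b f U → *-assoc _ _ _ }
  Λ-linear {suc m} a = record
    { ≈-cong = λ h → Λ-cong₂ {a = a} (λ _ _ → refl) h
    ; +-homo = λ f g U → trans
        (+-cong (+-homo Λ′ _ _ U) (trans (≈-cong La (+-homo Λ′ _ _) U) (+-homo La _ _ U)))
        (+-interchange′ _ _ _ _)
    ; *-homo = λ b f U → trans
        (+-cong (*-homo Λ′ b _ U) (trans (≈-cong La (*-homo Λ′ b _) U) (*-homo La b _ U)))
        (sym (distribˡ b _ _)) }
    where
    Λ′ = Λ-linear (a ∘ suc)
    La = L-linear (a zero)

  -- Multiplicativity of `Λ a` for products with a vector. Splitting off e₁, the term containing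
  -- `a₀` twice dies by `L-square`, and the minus sign in `L` is undone when `a₀` is moved past u by
  -- `L-anticomm`.
  Λ-L : ∀ {m n} (a : Fin m → Fin n → Carrier) (v : Fin m → Carrier) (x : E m) U →
    Λ a (L v x) U ≈ L (λ j → ∑ (λ i → v i * a i j)) (Λ a x) U
  Λ-L {zero}  a v x U = trans (zeroˡ _) (sym (L-0ᵥ (λ j → ∑-empty _) _ U))
  Λ-L {suc m} a v x U = begin
    Λ a′ (L v′ x₀) U + L a₀ (Λ a′ (λ S → v₀ * x₀ S + - L v′ x₁ S)) U
      ≈⟨ +-cong (Λ-L a′ v′ x₀ U) (≈-cong La (λ S → trans (+-homo Λ′ _ _ S) (+-cong (*-homo Λ′ v₀ x₀ S)
           (trans (neg-homo Λ′ _ S) (-‿cong (Λ-L a′ v′ x₁ S))))) U) ⟩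
    L u (Λ a′ x₀) U + L a₀ (λ S → v₀ * Λ a′ x₀ S + - L u (Λ a′ x₁) S) U
      ≈⟨ +-congˡ (trans (+-homo La _ _ U) (+-cong (*-homo La v₀ _ U) (trans (neg-homo La _ U) (sym (L-anticomm u a₀ _ U))))) ⟩
    L u (Λ a′ x₀) U + (v₀ * L a₀ (Λ a′ x₀) U + L u (L a₀ (Λ a′ x₁)) U)
      ≈⟨ solve 3 (λ p q r → p :+ (q :+ r) := q :+ (p :+ r)) refl _ _ _ ⟩
    v₀ * L a₀ (Λ a′ x₀) U + (L u (Λ a′ x₀) U + L u (L a₀ (Λ a′ x₁)) U)
      ≈⟨ +-cong (*-congˡ (trans (+-homo La _ _ U) (trans (+-congˡ (L-square a₀ _ U)) (+-identityʳ _))))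
                (+-homo (L-linear u) _ _ U) ⟨
    v₀ * L a₀ (Λ a x) U + L u (Λ a x) U
      ≈⟨ L-*+ᵥ v₀ a₀ u _ U ⟨
    L (λ j → v₀ * a₀ j + u j) (Λ a x) U
      ≈⟨ L-cong₂ (λ j → ∑-suc _) (λ _ → refl) U ⟨
    L (λ j → ∑ (λ i → v i * a i j)) (Λ a x) U ∎
    where
    v₀ = v zero
    v′ = v ∘ suc
    a₀ = a zero
    a′ = a ∘ suc
    x₀ = x ∘ (false ∷_)
    x₁ = x ∘ (true ∷_)
    u  = λ j → ∑ (λ i → v′ i * a′ i j)
    Λ′ = Λ-linear a′
    La = L-linear a₀

  Λ-1 : ∀ {m n} (a : Fin m → Fin n → Carrier) U → Λ a (mono ∅) U ≈ mono ∅ U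
  Λ-1 {zero}  a U = *-identityˡ _
  Λ-1 {suc m} a U = trans (+-cong (Λ-1 (a ∘ suc) U)
    (0-homo (L-linear (a zero)) (0-homo (Λ-linear (a ∘ suc)) (λ _ → refl)) U)) (+-identityʳ _)

  Λ-∘ : ∀ {m n p} (a : Fin n → Fin p → Carrier) (b : Fin m → Fin n → Carrier) f U →
    Λ a (Λ b f) U ≈ Λ (λ i k → ∑ (λ j → b i j * a j k)) f U
  Λ-∘ {zero}  a b f U = trans (*-homo (Λ-linear a) _ _ U) (*-congˡ (Λ-1 a U))
  Λ-∘ {suc m} a b f U = trans (+-homo (Λ-linear a) _ _ U)
    (+-cong (Λ-∘ a (b ∘ suc) _ U)
            (trans (Λ-L a (b zero) _ U) (L-cong _ (Λ-∘ a (b ∘ suc) _) U)))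

  -- If no image vector involves e₁, then `Λ a` lands in the exterior algebra on the remaining
  -- generators. For a diagonal matrix this applies to all rows after the first.
  Λ-shift-false : ∀ {m n} (a : Fin m → Fin (suc n) → Carrier) → (∀ i → a i zero ≈ 0#) → ∀ f U →
    Λ a f (false ∷ U) ≈ Λ (λ i j → a i (suc j)) f U
  Λ-shift-false {zero}  a h f U = refl
  Λ-shift-false {suc m} a h f U = +-cong (Λ-shift-false (a ∘ suc) (h ∘ suc) _ U)
    (L-cong _ (Λ-shift-false (a ∘ suc) (h ∘ suc) _) U)

  Λ-shift-true : ∀ {m n} (a : Fin m → Fin (suc n) → Carrier) → (∀ i → a i zero ≈ 0#) → ∀ f U →
    Λ a f (true ∷ U) ≈ 0#
  Λ-shift-true {zero}  a h f U = zeroʳ _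
  Λ-shift-true {suc m} a h f U = trans (+-cong (Λ-shift-true (a ∘ suc) (h ∘ suc) _ U)
    (trans (x+-0 (0-homo (L-linear _) (Λ-shift-true (a ∘ suc) (h ∘ suc) _) U))
           (trans (*-congʳ (h zero)) (zeroˡ _)))) (+-identityʳ _)

  monomial : ∀ {n} → (Fin n → Carrier) → Subset n → Carrier
  monomial d []          = 1#
  monomial d (true ∷ S)  = d zero * monomial (d ∘ suc) S
  monomial d (false ∷ S) = monomial (d ∘ suc) S

  Λ-diagonal : ∀ {n} (d : Fin n → Carrier) f U → Λ (λ i j → d i * idM i j) f U ≈ monomial d U * f U
  Λ-diagonal d f []          = trans (*-identityʳ _) (sym (*-identityˡ _))
  Λ-diagonal d f (false ∷ U) = trans
    (+-cong (trans (Λ-shift-false (λ i j → d (suc i) * idM (suc i) j) (λ i → zeroʳ _) _ U) (Λ-diagonal (d ∘ suc) _ U))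
            (L-0ᵥ (λ j → zeroʳ _) _ U))
    (+-identityʳ _)
  Λ-diagonal d f (true ∷ U)  = trans
    (+-cong (Λ-shift-true (λ i j → d (suc i) * idM (suc i) j) (λ i → zeroʳ _) _ U)
            (trans (x+-0 (L-0ᵥ (λ j → zeroʳ _) _ U))
              (*-cong (*-identityʳ _)
                (trans (Λ-shift-false (λ i j → d (suc i) * idM (suc i) j) (λ i → zeroʳ _) _ U) (Λ-diagonal (d ∘ suc) _ U)))))
    (trans (+-identityˡ _) (sym (*-assoc _ _ _)))

  -- `Λ a` preserves degree. Thanks to this, elements may be replaced by others that agree with them
  -- in degree k alone.
  Λ-degree : ∀ {m n} (a : Fin m → Fin n → Carrier) {f g : E m} U →
    (∀ S → card S ≡ card U → f S ≈ g S) → Λ a f U ≈ Λ a g U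
  Λ-degree {zero} {n} a {f} {g} U h with card U ℕ.≟ 0
  ... | yes e = *-congʳ (h [] (≡.sym e))
  ... | no ¬e = trans (vanish f) (sym (vanish g))
    where
    vanish : ∀ f → f [] * mono ∅ U ≈ 0#
    vanish f = trans (*-congˡ (mono-≢ {S = ∅} {U} λ { ≡.refl → ¬e (card-∅ n) })) (zeroʳ _)
  Λ-degree {suc m} a U h = +-cong (Λ-degree (a ∘ suc) U (h ∘ (false ∷_)))
    (L-degree (a zero) U λ S e → Λ-degree (a ∘ suc) S λ T e′ → h (true ∷ T) (≡.trans (cong suc e′) e))

  IsPoly-L : ∀ {n} {v : Carrier → Fin n → Carrier} {x : Carrier → E n} → (∀ i → IsPoly (λ t → v t i)) →
    (∀ S → IsPoly (λ t → x t S)) → ∀ U → IsPoly (λ t → L (v t) (x t) U)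
  IsPoly-L h k []          = IsPoly-const 0#
  IsPoly-L h k (false ∷ U) = IsPoly-L (h ∘ suc) (k ∘ (false ∷_)) U
  IsPoly-L h k (true ∷ U)  = IsPoly-+ (IsPoly-* (h zero) (k _)) (IsPoly-neg (IsPoly-L (h ∘ suc) (k ∘ (true ∷_)) U))

  IsPoly-Λ : ∀ {m n} {a : Carrier → Fin m → Fin n → Carrier} {f : Carrier → E m} → (∀ i j → IsPoly (λ t → a t i j)) →
    (∀ S → IsPoly (λ t → f t S)) → ∀ U → IsPoly (λ t → Λ (a t) (f t) U)
  IsPoly-Λ {zero}  h k U = IsPoly-* (k []) (IsPoly-const _)
  IsPoly-Λ {suc m} h k U = IsPoly-+ (IsPoly-Λ (h ∘ suc) (k ∘ (false ∷_)) U)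
    (IsPoly-L (h zero) (IsPoly-Λ (h ∘ suc) (k ∘ (true ∷_))) U)

  -- Comparison with the product and the action defined by sums over monomials

  vec : ∀ {n} → (Fin n → Carrier) → E n
  vec v U = sumFin (λ i → v i * mono (singleton i) U)

  -- The coefficient of e_U in e_i ∧ x.
  wedge₁ : ∀ {n} → Fin n → E n → E n
  wedge₁ i x U = ∑S (λ R → x R * wedgeCoeff (singleton i) R U)

  card-singleton : ∀ {n} (i : Fin n) → card (singleton i) ≡ 1
  card-singleton {suc n} zero    = cong suc (card-∅ n)
  card-singleton {suc n} (suc i) = card-singleton i

  disjointB-∅ : ∀ {n} (R : Subset n) → disjointB ∅ R ≡ true
  disjointB-∅ []      = ≡.refl
  disjointB-∅ (b ∷ R) = disjointB-∅ R

  unionS-∅ : ∀ {n} (R : Subset n) → unionS ∅ R ≡ R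
  unionS-∅ []      = ≡.refl
  unionS-∅ (b ∷ R) = cong (b ∷_) (unionS-∅ R)

  inversions-∅ : ∀ {n} (R : Subset n) → inversions ∅ R ≡ 0
  inversions-∅ []                = ≡.refl
  inversions-∅ {suc n} (true ∷ R)  = ≡.cong₂ ℕ._+_ (card-∅ n) (inversions-∅ R)
  inversions-∅ (false ∷ R)       = inversions-∅ R

  wedgeCoeff-∅ : ∀ {n} (R U : Subset n) → wedgeCoeff ∅ R U ≈ mono R U
  wedgeCoeff-∅ R U rewrite disjointB-∅ R | unionS-∅ R | inversions-∅ R = refl

  if-∧-false : ∀ b {s : Carrier} → (if b ∧ false then s else 0#) ≈ 0#
  if-∧-false true  = refl
  if-∧-false false = refl

  if-neg : ∀ b {s : Carrier} → (if b then - s else 0#) ≈ - (if b then s else 0#)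
  if-neg true  = refl
  if-neg false = sym -0#≈0#

  wedge₁-zero-true : ∀ {n} (x : E (suc n)) U → wedge₁ zero x (true ∷ U) ≈ x (false ∷ U)
  wedge₁-zero-true x U = begin
    wedge₁ zero x (true ∷ U)                           ≈⟨ ∑S-suc _ ⟩
    _ + ∑S (λ R → x (false ∷ R) * wedgeCoeff ∅ R U)    ≈⟨ +-cong (∑S-0 λ R → zeroʳ _)
                                                            (∑S-cong λ R → *-congˡ (trans (wedgeCoeff-∅ R U) (mono-sym R U))) ⟩
    0# + ∑S (λ R → x (false ∷ R) * mono U R)           ≈⟨ +-identityˡ _ ⟩
    ∑S (λ R → x (false ∷ R) * mono U R)                ≈⟨ ∑S-mono U (x ∘ (false ∷_)) ⟩
    x (false ∷ U)                                      ∎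

  wedge₁-zero-false : ∀ {n} (x : E (suc n)) U → wedge₁ zero x (false ∷ U) ≈ 0#
  wedge₁-zero-false x U = trans (∑S-suc _) (trans (+-cong
    (∑S-0 λ R → zeroʳ _)
    (∑S-0 λ R → trans (*-congˡ (if-∧-false (disjointB ∅ R))) (zeroʳ _))) (+-identityˡ _))

  wedge₁-suc-false : ∀ {n} (i : Fin n) (x : E (suc n)) U →
    wedge₁ (suc i) x (false ∷ U) ≈ wedge₁ i (x ∘ (false ∷_)) U
  wedge₁-suc-false i x U = trans (∑S-suc _) (trans (+-congʳ
    (∑S-0 λ R → trans (*-congˡ (if-∧-false (disjointB (singleton i) R))) (zeroʳ _))) (+-identityˡ _))

  wedge₁-suc-true : ∀ {n} (i : Fin n) (x : E (suc n)) U →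
    wedge₁ (suc i) x (true ∷ U) ≈ - wedge₁ i (x ∘ (true ∷_)) U
  wedge₁-suc-true i x U = begin
    wedge₁ (suc i) x (true ∷ U)
      ≈⟨ ∑S-suc _ ⟩
    ∑S (λ R → x (true ∷ R) * wedgeCoeff (false ∷ singleton i) (true ∷ R) (true ∷ U)) +
    ∑S (λ R → x (false ∷ R) * wedgeCoeff (false ∷ singleton i) (false ∷ R) (true ∷ U))
      ≈⟨ +-cong (∑S-cong λ R → *-congˡ (sign R))
                (∑S-0 λ R → trans (*-congˡ (if-∧-false (disjointB (singleton i) R))) (zeroʳ _)) ⟩
    ∑S (λ R → x (true ∷ R) * - wedgeCoeff (singleton i) R U) + 0#
      ≈⟨ +-identityʳ _ ⟩
    ∑S (λ R → x (true ∷ R) * - wedgeCoeff (singleton i) R U)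
      ≈⟨ ∑S-cong (λ R → trans (sym (-‿distribʳ-* _ _)) (-x≈-1*x _)) ⟩
    ∑S (λ R → - 1# * (x (true ∷ R) * wedgeCoeff (singleton i) R U))
      ≈⟨ trans (-x≈-1*x _) (*-∑S (- 1#) _) ⟨
    - wedge₁ i (x ∘ (true ∷_)) U ∎
    where
    -- Moving the single vector of `singleton i` past e₁ adds `card (singleton i)`, that is one, to
    -- the inversions and so flips the sign.
    sign : ∀ R → wedgeCoeff (false ∷ singleton i) (true ∷ R) (true ∷ U) ≈ - wedgeCoeff (singleton i) R U
    sign R rewrite card-singleton i = if-neg (disjointB (singleton i) R ∧ (unionS (singleton i) R == U))

  ∑-wedge₁ : ∀ {n} (v : Fin n → Carrier) x U → ∑ (λ i → v i * wedge₁ i x U) ≈ L v x U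
  ∑-wedge₁ v x []          = ∑-empty _
  ∑-wedge₁ v x (false ∷ U) = begin
    ∑ (λ i → v i * wedge₁ i x (false ∷ U))
      ≈⟨ ∑-suc _ ⟩
    v zero * wedge₁ zero x (false ∷ U) + ∑ (λ i → v (suc i) * wedge₁ (suc i) x (false ∷ U))
      ≈⟨ +-cong (trans (*-congˡ (wedge₁-zero-false x U)) (zeroʳ _)) (∑-cong λ i → *-congˡ (wedge₁-suc-false i x U)) ⟩
    0# + ∑ (λ i → v (suc i) * wedge₁ i (x ∘ (false ∷_)) U)
      ≈⟨ trans (+-identityˡ _) (∑-wedge₁ (v ∘ suc) _ U) ⟩
    L v x (false ∷ U) ∎
  ∑-wedge₁ v x (true ∷ U)  = begin
    ∑ (λ i → v i * wedge₁ i x (true ∷ U))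
      ≈⟨ ∑-suc _ ⟩
    v zero * wedge₁ zero x (true ∷ U) + ∑ (λ i → v (suc i) * wedge₁ (suc i) x (true ∷ U))
      ≈⟨ +-cong (*-congˡ (wedge₁-zero-true x U)) (∑-cong λ i → trans (*-congˡ (wedge₁-suc-true i x U)) (sym (-‿distribʳ-* _ _))) ⟩
    v zero * x (false ∷ U) + ∑ (λ i → - (v (suc i) * wedge₁ i (x ∘ (true ∷_)) U))
      ≈⟨ +-congˡ (trans (∑-neg _) (-‿cong (∑-wedge₁ (v ∘ suc) _ U))) ⟩
    L v x (true ∷ U) ∎

  ∧E-∑S : ∀ {n} (f g : E n) U → (f ∧E g) U ≈ ∑S (λ S → f S * ∑S (λ R → g R * wedgeCoeff S R U))
  ∧E-∑S {n} f g U = begin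
    (f ∧E g) U
      ≈⟨ sumL-cong (allSubsets n) (λ S → reflexive (∑S≡sumL _)) ⟨
    sumL (allSubsets n) (λ S → ∑S (λ R → (f S * g R) * wedgeCoeff S R U))
      ≈⟨ reflexive (∑S≡sumL _) ⟨
    ∑S (λ S → ∑S (λ R → (f S * g R) * wedgeCoeff S R U))
      ≈⟨ ∑S-cong (λ S → trans (*-∑S (f S) _) (∑S-cong λ R → sym (*-assoc _ _ _))) ⟨
    ∑S (λ S → f S * ∑S (λ R → g R * wedgeCoeff S R U)) ∎

  vec-∧E : ∀ {n} (v : Fin n → Carrier) (x : E n) U → (vec v ∧E x) U ≈ L v x U
  vec-∧E v x U = begin
    (vec v ∧E x) U
      ≈⟨ ∧E-∑S (vec v) x U ⟩
    ∑S (λ S → vec v S * G S)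
      ≈⟨ ∑S-cong (λ S → *-congʳ (reflexive (∑≡sumFin _))) ⟨
    ∑S (λ S → ∑ (λ i → v i * mono (singleton i) S) * G S)
      ≈⟨ ∑S-cong (λ S → ∑-* _ (G S)) ⟩
    ∑S (λ S → ∑ (λ i → v i * mono (singleton i) S * G S))
      ≈⟨ ∑S-∑ (λ i S → v i * mono (singleton i) S * G S) ⟩
    ∑ (λ i → ∑S (λ S → v i * mono (singleton i) S * G S))
      ≈⟨ ∑-cong (λ i → ∑S-cong λ S → solve 3 (λ a b c → a :* b :* c := a :* c :* b) refl _ _ _) ⟩
    ∑ (λ i → ∑S (λ S → v i * G S * mono (singleton i) S))
      ≈⟨ ∑-cong (λ i → ∑S-mono (singleton i) _) ⟩
    ∑ (λ i → v i * wedge₁ i x U)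
      ≈⟨ ∑-wedge₁ v x U ⟩
    L v x U ∎
    where
    G : Subset _ → Carrier
    G S = ∑S (λ R → x R * wedgeCoeff S R U)

  wedgeVectors : ∀ {m n} → (Fin m → Fin n → Carrier) → Subset m → E n
  wedgeVectors a []          = mono ∅
  wedgeVectors a (true ∷ S)  = L (a zero) (wedgeVectors (a ∘ suc) S)
  wedgeVectors a (false ∷ S) = wedgeVectors (a ∘ suc) S

  -- The elements of a tail are listed as a mapped list; the renaming g accumulates these maps and
  -- is the identity in the application.
  foldr-elems : ∀ {m n} (A : Matrix n) (g : Fin m → Fin n) (S : Subset m) U →
    foldr (λ j acc → φlin A j ∧E acc) (mono ∅) (map g (elems S)) U ≈ wedgeVectors (λ j i → A i (g j)) S U
  foldr-elems A g []          U = refl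
  foldr-elems A g (true ∷ S)  U = begin
    (φlin A (g zero) ∧E foldr (λ j acc → φlin A j ∧E acc) (mono ∅) (map g (map suc (elems S)))) U
      ≈⟨ vec-∧E (λ i → A i (g zero)) _ U ⟩
    L (λ i → A i (g zero)) (foldr (λ j acc → φlin A j ∧E acc) (mono ∅) (map g (map suc (elems S)))) U
      ≈⟨ L-cong _ (λ V → trans (reflexive (cong (λ l → foldr (λ j acc → φlin A j ∧E acc) (mono ∅) l V) (≡.sym (map-∘ (elems S)))))
           (foldr-elems A (g ∘ suc) S V)) U ⟩
    L (λ i → A i (g zero)) (wedgeVectors (λ j i → A i (g (suc j))) S) U ∎
  foldr-elems A g (false ∷ S) U = trans
    (reflexive (cong (λ l → foldr (λ j acc → φlin A j ∧E acc) (mono ∅) l U) (≡.sym (map-∘ (elems S)))))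
    (foldr-elems A (g ∘ suc) S U)

  ∑S-wedgeVectors : ∀ {m n} (a : Fin m → Fin n → Carrier) f U →
    ∑S (λ S → f S * wedgeVectors a S U) ≈ Λ a f U
  ∑S-wedgeVectors {zero}  a f U = ∑S-[] _
  ∑S-wedgeVectors {suc m} a f U = begin
    ∑S (λ S → f S * wedgeVectors a S U)
      ≈⟨ ∑S-suc _ ⟩
    ∑S (λ S → f (true ∷ S) * L (a zero) (wedgeVectors (a ∘ suc) S) U) + ∑S (λ S → f (false ∷ S) * wedgeVectors (a ∘ suc) S U)
      ≈⟨ +-cong (trans (∑S-cong λ S → sym (*-homo La _ _ U)) (sym (∑S-homo La (λ S V → f (true ∷ S) * wedgeVectors (a ∘ suc) S V) U)))
                (∑S-wedgeVectors (a ∘ suc) _ U) ⟩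
    L (a zero) (λ V → ∑S (λ S → f (true ∷ S) * wedgeVectors (a ∘ suc) S V)) U + Λ (a ∘ suc) (f ∘ (false ∷_)) U
      ≈⟨ +-congʳ (L-cong _ (∑S-wedgeVectors (a ∘ suc) _) U) ⟩
    L (a zero) (Λ (a ∘ suc) (f ∘ (true ∷_))) U + Λ (a ∘ suc) (f ∘ (false ∷_)) U
      ≈⟨ +-comm _ _ ⟩
    Λ a f U ∎
    where La = L-linear (a zero)

  _ᵗ : ∀ {n} → Matrix n → Fin n → Fin n → Carrier
  (A ᵗ) j i = A i j

  act≈Λ : ∀ {n} (A : Matrix n) f U → act A f U ≈ Λ (A ᵗ) f U
  act≈Λ {n} A f U = begin
    act A f U
      ≈⟨ reflexive (∑S≡sumL _) ⟨
    ∑S (λ S → f S * φmono A S U)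
      ≈⟨ ∑S-cong (λ S → *-congˡ (trans
           (reflexive (cong (λ l → foldr (λ j acc → φlin A j ∧E acc) (mono ∅) l U) (≡.sym (map-id (elems S)))))
           (foldr-elems A id S U))) ⟩
    ∑S (λ S → f S * wedgeVectors (A ᵗ) S U)
      ≈⟨ ∑S-wedgeVectors (A ᵗ) f U ⟩
    Λ (A ᵗ) f U ∎

-- Enumerating and counting nonfaces

lookup-injective : ∀ {A : Set} {xs : List A} → Unique xs → ∀ i j → List.lookup xs i ≡ List.lookup xs j → i ≡ j
lookup-injective (p ∷ u) zero    zero    e = ≡.refl
lookup-injective (p ∷ u) zero    (suc j) e = ⊥-elim (All.lookup p (∈-lookup j) e)
lookup-injective (p ∷ u) (suc i) zero    e = ⊥-elim (All.lookup p (∈-lookup i) (≡.sym e))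
lookup-injective (p ∷ u) (suc i) (suc j) e = cong suc (lookup-injective u i j e)

∷-injectiveʳ : ∀ {n b} {S R : Subset n} → _≡_ {A = Subset (suc n)} (b ∷ S) (b ∷ R) → S ≡ R
∷-injectiveʳ ≡.refl = ≡.refl

allSubsets-unique : ∀ n → Unique (allSubsets n)
allSubsets-unique zero    = [] ∷ []
allSubsets-unique (suc n) = Unique.++⁺ (Unique.map⁺ ∷-injectiveʳ u) (Unique.map⁺ ∷-injectiveʳ u) disjoint
  where
  u = allSubsets-unique n
  disjoint : ∀ {S} → ¬ (S ∈ map (true ∷_) (allSubsets n) × S ∈ map (false ∷_) (allSubsets n))
  disjoint (p , q) with ∈-map⁻ (true ∷_) p | ∈-map⁻ (false ∷_) q
  ... | _ , _ , ≡.refl | _ , _ , ()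

∈-allSubsets : ∀ {n} (S : Subset n) → S ∈ allSubsets n
∈-allSubsets []          = here ≡.refl
∈-allSubsets (true ∷ S)  = ∈-++⁺ˡ (∈-map⁺ (true ∷_) (∈-allSubsets S))
∈-allSubsets {suc n} (false ∷ S) = ∈-++⁺ʳ (map (true ∷_) (allSubsets n)) (∈-map⁺ (false ∷_) (∈-allSubsets S))

subsets : ∀ {n} → (Subset n → Bool) → List (Subset n)
subsets {n} p = filter (λ S → T? (p S)) (allSubsets n)

subsets-unique : ∀ {n} (p : Subset n → Bool) → Unique (subsets p)
subsets-unique {n} p = Unique.filter⁺ (λ S → T? (p S)) (allSubsets-unique n)

∈-subsets : ∀ {n} (p : Subset n → Bool) {S} → T (p S) → S ∈ subsets p
∈-subsets p {S} = ∈-filter⁺ (λ S → T? (p S)) (∈-allSubsets S)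

subsets-lookup : ∀ {n} (p : Subset n → Bool) i → T (p (List.lookup (subsets p) i))
subsets-lookup {n} p i = proj₂ (∈-filter⁻ (λ S → T? (p S)) {xs = allSubsets n} (∈-lookup {xs = subsets p} i))

-- With b = w(S) and k = |S| this selects the nonfaces R ≻rev S of size k; with b = 2^n it selects
-- all nonfaces of size k.
nonface : ∀ {n} → (Subset n → Bool) → ℕ → ℕ → Subset n → Bool
nonface τ k b R = not (τ R) ∧ (card R ≡ᵇ k) ∧ (w R <ᵇ b)

nonface-intro : ∀ {n} (τ : Subset n → Bool) {k b} R → τ R ≡ false → card R ≡ k → w R ℕ.< b → T (nonface τ k b R)
nonface-intro τ R e ce lt rewrite e = T-∧-intro (ℕ.≡⇒≡ᵇ _ _ ce) (ℕ.<⇒<ᵇ lt)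

nonface-elim : ∀ {n} (τ : Subset n → Bool) {k b} R → T (nonface τ k b R) → τ R ≡ false × card R ≡ k × w R ℕ.< b
nonface-elim τ {k} R t with τ R
... | false with Equivalence.to (T-∧ {card R ≡ᵇ k}) t
...   | ce , lt = ≡.refl , ℕ.≡ᵇ⇒≡ _ _ ce , ℕ.<ᵇ⇒< _ _ lt

#nonfaces : ∀ {n} → (Subset n → Bool) → ℕ → ℕ → ℕ
#nonfaces τ k b = length (subsets (nonface τ k b))

⊆S-unionS : ∀ {n} (R S : Subset n) → S ⊆S unionS R S
⊆S-unionS []          []          = tt
⊆S-unionS (true ∷ R)  (true ∷ S)  = ⊆S-unionS R S
⊆S-unionS (true ∷ R)  (false ∷ S) = ⊆S-unionS R S
⊆S-unionS (false ∷ R) (true ∷ S)  = ⊆S-unionS R S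
⊆S-unionS (false ∷ R) (false ∷ S) = ⊆S-unionS R S

-- Among the sets R ⪯rev S of size |S| the faces are what the nonfaces leave, and these nonfaces are
-- all nonfaces of that size without those ≻rev S. Written with sums to avoid truncated subtraction;
-- the first summand on the right is the same for every complex.
m⪯-+-#nonfaces : ∀ {n} (τ : Subset n → Bool) (S : Subset n) →
  m⪯ S τ ℕ.+ #nonfaces τ (card S) (2 ℕ.^ n) ≡
  length (subsets (λ R → (card R ≡ᵇ card S) ∧ (R ⪯rev S))) ℕ.+ #nonfaces τ (card S) (w S)
m⪯-+-#nonfaces {n} τ S = count-+ _ _ _ _ pointwise (allSubsets n)
  where
  cases : ∀ t c l x y → (c ≡ true → l ≡ not x) → y ≡ true →
    𝟙 (t ∧ c ∧ l) ℕ.+ 𝟙 (not t ∧ c ∧ y) ≡ 𝟙 (c ∧ l) ℕ.+ 𝟙 (not t ∧ c ∧ x)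
  cases true  false l x y h e = ≡.refl
  cases false false l x y h e = ≡.refl
  cases t     true  l x y h e rewrite h ≡.refl | e with t | x
  ... | true  | true  = ≡.refl
  ... | true  | false = ≡.refl
  ... | false | true  = ≡.refl
  ... | false | false = ≡.refl
  pointwise : ∀ R → 𝟙 (τ R ∧ (card R ≡ᵇ card S) ∧ (R ⪯rev S)) ℕ.+ 𝟙 (nonface τ (card S) (2 ℕ.^ n) R) ≡
    𝟙 ((card R ≡ᵇ card S) ∧ (R ⪯rev S)) ℕ.+ 𝟙 (nonface τ (card S) (w S) R)
  pointwise R = cases (τ R) (card R ≡ᵇ card S) (R ⪯rev S) (w R <ᵇ w S) (w R <ᵇ 2 ℕ.^ n)
    (λ e → ⪯rev≡≥w R S (ℕ.≡ᵇ⇒≡ _ _ (≡true⇒T e))) (≡true (ℕ.<⇒<ᵇ (w<2^n R)))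

-- Face ideals, initial monomials and dimension counts

module Shifting {c ℓ : Level} (F : Field c ℓ) where
  open Field F hiding (zero)
  open Ext F
  open LinearAlgebra F
  open Exterior F
  open Linear

  -- Membership in J_σ as a linear condition on coefficients: for a complex σ it is equivalent to
  -- `faceIdeal σ f`, and linear combinations preserve it at sight.
  VanishesOn : ∀ {n} → (Subset n → Bool) → E n → Set ℓ
  VanishesOn σ f = ∀ S → σ S ≡ true → f S ≈ 0#

  ∧E-mono : ∀ {n} (a : E n) S U → (a ∧E mono S) U ≈ ∑S (λ R → a R * wedgeCoeff R S U)
  ∧E-mono a S U = trans (∧E-∑S a (mono S) U) (∑S-cong λ R → *-congˡ
    (trans (∑S-cong λ _ → *-comm _ _) (∑S-mono S (λ T → wedgeCoeff R T U))))

  wedgeCoeff-⊈ : ∀ {n} (R S U : Subset n) → ¬ (S ⊆S U) → wedgeCoeff R S U ≈ 0#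
  wedgeCoeff-⊈ R S U S⊈U with unionS R S == U in e
  ... | false = if-∧-false (disjointB R S)
  ... | true  = ⊥-elim (S⊈U (subst (S ⊆S_) (==-sound _ _ e) (⊆S-unionS R S)))

  1∧mono : ∀ {n} a (S U : Subset n) → ((λ R → a * mono ∅ R) ∧E mono S) U ≈ a * mono S U
  1∧mono a S U = begin
    ((λ R → a * mono ∅ R) ∧E mono S) U                  ≈⟨ ∧E-mono _ S U ⟩
    ∑S (λ R → a * mono ∅ R * wedgeCoeff R S U)          ≈⟨ ∑S-cong (λ R → solve 3 (λ a m x → a :* m :* x := a :* x :* m) refl _ _ _) ⟩
    ∑S (λ R → a * wedgeCoeff R S U * mono ∅ R)          ≈⟨ ∑S-mono ∅ (λ R → a * wedgeCoeff R S U) ⟩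
    a * wedgeCoeff ∅ S U                                ≈⟨ *-congˡ (wedgeCoeff-∅ S U) ⟩
    a * mono S U                                        ∎

  -- A multiple of e_S has coefficients only at supersets of S. The statement is contrapositive, so
  -- no generator has to be singled out from a sum.
  MonIdeal-coefficient : ∀ {n} {P : Subset n → Set (c ⊔ ℓ)} {f} → MonIdeal P f →
    ∀ U → (∀ S → P S → ¬ (S ⊆S U)) → f U ≈ 0#
  MonIdeal-coefficient (izero f e)            U none = e U
  MonIdeal-coefficient (igen a S PS f e)      U none = trans (e U) (trans (∧E-mono a S U)
    (∑S-0 λ R → trans (*-congˡ (wedgeCoeff-⊈ R S U (none S PS))) (zeroʳ _)))
  MonIdeal-coefficient (iadd f g fI gI h e)   U none = trans (e U) (trans
    (+-cong (MonIdeal-coefficient fI U none) (MonIdeal-coefficient gI U none)) (+-identityˡ 0#))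

  MonIdeal-mono : ∀ {n} {P : Subset n → Set (c ⊔ ℓ)} {S} → P S → ∀ a → MonIdeal P (λ U → a * mono S U)
  MonIdeal-mono {S = S} PS a = igen (λ R → a * mono ∅ R) S PS _ (λ U → sym (1∧mono a S U))

  MonIdeal-cong : ∀ {n} {P : Subset n → Set (c ⊔ ℓ)} {f g} → MonIdeal P f → g ≈E f → MonIdeal P g
  MonIdeal-cong fI e = iadd zeroE _ (izero _ (λ _ → refl)) fI _ (λ U → trans (e U) (sym (+-identityˡ _)))

  faceIdeal⇒VanishesOn : ∀ {n} {σ : Subset n → Bool} → IsComplex σ → ∀ {f} → faceIdeal σ f → VanishesOn σ f
  faceIdeal⇒VanishesOn cx fI U σU = MonIdeal-coefficient fI U λ S (lift σS) S⊆U →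
    false≢true (≡true (cx S U S⊆U (≡true⇒T σU))) σS

  VanishesOn⇒faceIdeal : ∀ {n} {σ : Subset n → Bool} {f} → VanishesOn σ f → faceIdeal σ f
  VanishesOn⇒faceIdeal {n} {σ} {f} v = MonIdeal-cong (sumI (allSubsets n)) λ U → begin
    f U                                              ≈⟨ ∑S-mono U f ⟨
    ∑S (λ S → f S * mono U S)                        ≈⟨ ∑S-cong (λ S → *-congˡ (mono-sym U S)) ⟩
    ∑S (λ S → f S * mono S U)                        ≈⟨ reflexive (∑S≡sumL _) ⟩
    sumL (allSubsets n) (λ S → f S * mono S U)       ∎
    where
    term : ∀ S → faceIdeal σ (λ U → f S * mono S U)
    term S with σ S in e
    ... | true  = izero _ (λ U → trans (*-congʳ (v S e)) (zeroˡ _))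
    ... | false = MonIdeal-mono (lift e) (f S)
    sumI : ∀ xs → faceIdeal σ (λ U → sumL xs (λ S → f S * mono S U))
    sumI []       = izero _ (λ _ → refl)
    sumI (S ∷ xs) = iadd _ _ (term S) (sumI xs) _ (λ _ → refl)

  VanishesOn-combination : ∀ {n r} {σ : Subset n → Bool} (a : Fin r → Carrier) {f : Fin r → E n} →
    (∀ i → VanishesOn σ (f i)) → VanishesOn σ (λ S → ∑ (λ i → a i * f i S))
  VanishesOn-combination a v S σS = ∑-0 λ i → trans (*-congˡ (v i S σS)) (zeroʳ _)

  Φ : ∀ {n} → Matrix n → E n → E n
  Φ A = Λ (A ᵗ)

  Φ-· : ∀ {n} (A B : Matrix n) f U → Φ A (Φ B f) U ≈ Φ (A · B) f U
  Φ-· A B f U = trans (Λ-∘ (A ᵗ) (B ᵗ) f U)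
    (Λ-cong₂ (λ i k → ∑-cong λ j → *-comm (B j i) (A k j)) (λ _ → refl) U)

  Φ-idM : ∀ {n} (f : E n) U → Φ idM f U ≈ f U
  Φ-idM f U = begin
    Λ (idM ᵗ) f U                        ≈⟨ Λ-cong₂ (λ i j → trans (idM-sym j i) (sym (*-identityˡ _))) (λ _ → refl) U ⟩
    Λ (λ i j → 1# * idM i j) f U         ≈⟨ Λ-diagonal (λ _ → 1#) f U ⟩
    monomial (λ _ → 1#) U * f U          ≈⟨ *-congʳ (monomial-1 U) ⟩
    1# * f U                             ≈⟨ *-identityˡ _ ⟩
    f U                                  ∎
    where
    monomial-1 : ∀ {n} (U : Subset n) → monomial (λ _ → 1#) U ≈ 1#
    monomial-1 []          = refl
    monomial-1 (true ∷ U)  = trans (*-identityˡ _) (monomial-1 U)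
    monomial-1 (false ∷ U) = monomial-1 U

  -- Only the coefficients of degree |R| are constrained. This suffices because J_σ and Φ are
  -- graded, so the other degrees of f can be cut away.
  InitialIn : ∀ {n} → Matrix n → (Subset n → Bool) → Subset n → Set (c ⊔ ℓ)
  InitialIn {n} A σ R = Σ (E n) λ f → VanishesOn σ f × ¬ (Φ A f R ≈ 0#) ×
    (∀ U → card U ≡ card R → w U ℕ.< w R → Φ A f U ≈ 0#)

  truncate : ∀ {n} → ℕ → E n → E n
  truncate k f S = if card S ≡ᵇ k then f S else 0#

  truncate-≡ : ∀ {n k} (f : E n) S → card S ≡ k → truncate k f S ≈ f S
  truncate-≡ {k = k} f S e rewrite ≡true (ℕ.≡⇒≡ᵇ (card S) k e) = refl

  truncate-≢ : ∀ {n k} (f : E n) S → card S ≢ k → truncate k f S ≈ 0#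
  truncate-≢ {k = k} f S ne rewrite ≡false (ne ∘ ℕ.≡ᵇ⇒≡ (card S) k) = refl

  truncate-VanishesOn : ∀ {n k} {σ : Subset n → Bool} {f} → VanishesOn σ f → VanishesOn σ (truncate k f)
  truncate-VanishesOn {k = k} v S σS with card S ≡ᵇ k
  ... | true  = v S σS
  ... | false = refl

  Φ-truncate-≡ : ∀ {n k} A (f : E n) U → card U ≡ k → Φ A (truncate k f) U ≈ Φ A f U
  Φ-truncate-≡ A f U e = Λ-degree (A ᵗ) U λ S e′ → truncate-≡ f S (≡.trans e′ e)

  Φ-truncate-≢ : ∀ {n k} A (f : E n) U → card U ≢ k → Φ A (truncate k f) U ≈ 0#
  Φ-truncate-≢ A f U ne = trans
    (Λ-degree (A ᵗ) U λ S e′ → truncate-≢ f S (λ e → ne (≡.trans (≡.sym e′) e)))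
    (0-homo (Λ-linear (A ᵗ)) {λ _ → 0#} (λ _ → refl) U)

  InitialIn⇒nonface : ∀ {n} (A : Matrix n) {σ τ} → IsComplex τ →
    faceIdeal τ ≐ initialIdeal (image A (faceIdeal σ)) → ∀ R → InitialIn A σ R → τ R ≡ false
  InitialIn⇒nonface {n} A {σ} {τ} cx eq R (f , fσ , nz , below) = ≡false λ τR →
    1≉0 (trans (sym (mono-diag R)) (faceIdeal⇒VanishesOn cx mono∈ R (≡true τR)))
    where
    -- `IsInitial` also asks for zero coefficients at all larger cardinalities; the truncation
    -- provides them and stays in J_σ.
    g = truncate (card R) f
    initial : IsInitial (act A g) R
    initial = (λ e → nz (trans (sym (Φ-truncate-≡ A f R ≡.refl)) (trans (sym (act≈Λ A g R)) e))) , λ U R≺U → trans (act≈Λ A g U) (above U R≺U)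
      where
      above : ∀ U → T (R ≺rev U) → Φ A g U ≈ 0#
      above U R≺U with ≺rev⇒ R U R≺U
      ... | inj₁ c<        = Φ-truncate-≢ A f U (λ e → ℕ.<-irrefl (≡.sym e) c<)
      ... | inj₂ (e , w<) = trans (Φ-truncate-≡ A f U (≡.sym e)) (below U (≡.sym e) w<)
    mono∈ : faceIdeal τ (mono R)
    mono∈ = proj₂ (eq (mono R)) (MonIdeal-cong
      (MonIdeal-mono (act A g , (g , VanishesOn⇒faceIdeal (truncate-VanishesOn fσ) , λ _ → refl) , lift initial) 1#)
      (λ U → sym (*-identityˡ _)))

  -- If f has initial monomial e_S after A, then A⁻¹e_j ∧ f has initial monomial ± e_{S ∪ j}.
  InitialIn-Ins : ∀ {n} (A B : Matrix n) → (A · B) ≈M idM → ∀ {σ} → IsComplex σ →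
    ∀ {j S U} → Ins j S U → InitialIn A σ S → InitialIn A σ U
  InitialIn-Ins A B AB≈1 {σ} cx {j} {S} {U} ins (f , fσ , nz , below) = f′ , f′σ , nz′ , below′
    where
    f′ = L (λ i → B i j) f
    f′σ : VanishesOn σ f′
    f′σ V σV = L-vanishes-below _ V λ T T⊆V → fσ T (≡true (cx T V T⊆V (≡true⇒T σV)))
    Φf′ : ∀ V → Φ A f′ V ≈ L (basisVector j) (Φ A f) V
    Φf′ V = trans (Λ-L (A ᵗ) _ f V)
      (L-cong₂ (λ k → trans (∑-cong λ i → *-comm _ _) (AB≈1 k j)) (λ _ → refl) V)
    nz′ : ¬ (Φ A f′ U ≈ 0#)
    nz′ e with L-basis-Ins ins (Φ A f)
    ... | inj₁ e′ = nz (trans (sym e′) (trans (sym (Φf′ U)) e))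
    ... | inj₂ e′ = -‿≉0 nz (trans (sym e′) (trans (sym (Φf′ U)) e))
    below′ : ∀ V → card V ≡ card U → w V ℕ.< w U → Φ A f′ V ≈ 0#
    below′ V ce wlt with ∉⊎Ins j V
    ... | inj₁ j∉V = trans (Φf′ V) (L-basis-∉ j V j∉V _)
    ... | inj₂ (V₀ , ins₀) = trans (Φf′ V) (zero-case (L-basis-Ins ins₀ (Φ A f)))
      where
      z : Φ A f V₀ ≈ 0#
      z = below V₀ (ℕ.suc-injective (≡.trans (≡.sym (card-Ins ins₀)) (≡.trans ce (card-Ins ins))))
        (ℕ.+-cancelˡ-< (bit j) _ _ (≡.subst₂ ℕ._<_ (w-Ins ins₀) (w-Ins ins) wlt))
      zero-case : _ ⊎ _ → L (basisVector j) (Φ A f) V ≈ 0#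
      zero-case (inj₁ e) = trans e z
      zero-case (inj₂ e) = trans e (trans (-‿cong z) -0#≈0#)

  -- Since e_R lies in the initial ideal, some initial monomial e_S has S ⊆ R, and initiality passes
  -- up from S to R by insertions. The double negation arises because `MonIdeal-coefficient` merely
  -- refutes the absence of such an S.
  nonface⇒InitialIn : ∀ {n} (A : Matrix n) → Invertible A → ∀ {σ τ} → IsComplex σ →
    faceIdeal τ ≐ initialIdeal (image A (faceIdeal σ)) → ∀ R → τ R ≡ false → ¬ ¬ InitialIn A σ R
  nonface⇒InitialIn A (B , AB≈1 , _) {σ} {τ} cx eq R τR k =
    1≉0 (trans (sym (mono-diag R)) (MonIdeal-coefficient mono∈ R λ S PS S⊆R →
      k (upward-closed (InitialIn A σ) (InitialIn-Ins A B (λ i j → trans (·≈·M A B i j) (AB≈1 i j)) cx) S R S⊆R (fromInitial S PS))))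
    where
    mono∈ : initialIdeal (image A (faceIdeal σ)) (mono R)
    mono∈ = proj₁ (eq (mono R)) (MonIdeal-cong (MonIdeal-mono (lift τR) 1#) (λ U → sym (*-identityˡ _)))
    fromInitial : ∀ S → _ → InitialIn A σ S
    fromInitial S (g , (f , fI , g≈) , lift (nz , above)) =
      f , faceIdeal⇒VanishesOn cx fI , (λ e → nz (trans (gΦ S) e)) ,
      λ U ce w< → trans (sym (gΦ U)) (above U (⇒≺rev S U (≡.sym ce) w<))
      where
      gΦ : ∀ U → g U ≈ Φ A f U
      gΦ U = trans (g≈ U) (act≈Λ A f U)

  ∑-single : ∀ {r} (j : Fin r) {f : Fin r → Carrier} → (∀ i → i ≢ j → f i ≈ 0#) → ∑ f ≈ f j
  ∑-single zero    h = trans (∑-suc _) (trans (+-congˡ (∑-0 λ i → h (suc i) λ ())) (+-identityʳ _))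
  ∑-single (suc j) h = trans (∑-suc _) (trans (+-cong (h zero λ ()) (∑-single j λ i ne → h (suc i) (ne ∘ Fin.suc-injective))) (+-identityˡ _))

  -- Sorted by weight the matrix is triangular with nonzero diagonal, so the coefficients of a
  -- relation vanish one after the other, lowest weight first.
  distinct-initials⇒RowsIndependent : ∀ {n r} (R : Fin r → Subset n) → (∀ i j → R i ≡ R j → i ≡ j) →
    (x : Fin r → E n) → (∀ i → ¬ (x i (R i) ≈ 0#)) → (∀ i j → w (R j) ℕ.< w (R i) → x i (R j) ≈ 0#) →
    RowsIndependent (λ i j → x i (R j))
  distinct-initials⇒RowsIndependent {n} {r} R inj x nz below a h j =
    <-rec (λ m → ∀ j → w (R j) ≡ m → a j ≈ 0#) step (w (R j)) j ≡.refl
    where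
    step : ∀ m → (∀ {m′} → m′ ℕ.< m → ∀ j → w (R j) ≡ m′ → a j ≈ 0#) → ∀ j → w (R j) ≡ m → a j ≈ 0#
    step m ih j ≡.refl = cancelʳ (nz j) (trans (sym (∑-single j others)) (h j))
      where
      others : ∀ i → i ≢ j → a i * x i (R j) ≈ 0#
      others i i≢j with ℕ.<-cmp (w (R i)) (w (R j))
      ... | tri< lt _ _ = trans (*-congʳ (ih lt i ≡.refl)) (zeroˡ _)
      ... | tri≈ _ e _  = ⊥-elim (i≢j (inj i j (w-injective _ _ e)))
      ... | tri> _ _ gt = trans (*-congˡ (below i j gt)) (zeroʳ _)

  -- With more elements than nonfaces, some nontrivial combination has image zero at all counted
  -- nonfaces. A lowest nonzero coefficient below b would sit at an initial monomial, hence at a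
  -- nonface; so the image vanishes at every U of size k and weight below b, against independence.
  independent⇒≤#nonfaces : ∀ {n} (A : Matrix n) {σ τ} → (∀ R → InitialIn A σ R → τ R ≡ false) →
    ∀ k b {r} (f : Fin r → E n) → (∀ i → VanishesOn σ (f i)) →
    (∀ a → (∀ U → card U ≡ k → w U ℕ.< b → ∑ (λ i → a i * Φ A (f i) U) ≈ 0#) → ∀ i → a i ≈ 0#) →
    r ℕ.≤ #nonfaces τ k b
  independent⇒≤#nonfaces {n} A {σ} {τ} init k b {r} f fσ ind with r ℕ.≤? #nonfaces τ k b
  ... | yes le = le
  ... | no ¬le = ⊥-elim (contra id)
    where
    contra : ¬ ¬ ⊥
    contra = do
      (a , (i , nz) , h) ← dependent (subsets (nonface τ k b)) (ℕ.≰⇒> ¬le) (λ i → Φ A (f i))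
      z ← vanishes a h b
      return (nz (ind a (λ U ce w<b → z U ce w<b w<b) i))
      where
      vanishes : ∀ a → All (λ U → ∑ (λ i → a i * Φ A (f i) U) ≈ 0#) (subsets (nonface τ k b)) →
        ∀ m → ¬ ¬ (∀ U → card U ≡ k → w U ℕ.< b → w U ℕ.< m → ∑ (λ i → a i * Φ A (f i) U) ≈ 0#)
      vanishes a h zero    = return λ U ce w<b ()
      vanishes a h (suc m) = do
        ih ← vanishes a h m
        -- Given a refutation `k′` of the claim at U, the coefficient there is nonzero. Then U is
        -- initial and therefore a nonface, where `h` makes the coefficient zero.
        ¬¬-∀Subset n (λ U k′ → k′ (λ ce w<b w≤m → ⊥-elim (k′ (λ _ _ _ →
          All.lookup h (∈-subsets (nonface τ k b) (nonface-intro τ U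
            (init U ( (λ S → ∑ (λ i → a i * f i S)) , VanishesOn-combination a fσ
                    , (λ e → k′ (λ _ _ _ → trans (sym (Φlc U)) e))
                    , λ V ce′ w< → trans (Φlc V) (ih V (≡.trans ce′ ce) (ℕ.<-trans w< w<b) (ℕ.<-≤-trans w< (ℕ.≤-pred w≤m)))))
            ce w<b))))))
        where
        Φlc : ∀ U → Φ A (λ S → ∑ (λ i → a i * f i S)) U ≈ ∑ (λ i → a i * Φ A (f i) U)
        Φlc U = linear-combination (Λ-linear (A ᵗ)) a f U

  -- Elements of J_σ whose images have distinct initial monomials are independent, so in degree k
  -- there are at most dim (J_σ)_k of them, which is the number of nonfaces of σ of size k.
  #nonfaces-initial≤ : ∀ {n} (A : Matrix n) {σ τ} → (∀ R → τ R ≡ false → ¬ ¬ InitialIn A σ R) →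
    ∀ k → #nonfaces τ k (2 ℕ.^ n) ℕ.≤ #nonfaces σ k (2 ℕ.^ n)
  #nonfaces-initial≤ {n} A {σ} {τ} init k with #nonfaces τ k (2 ℕ.^ n) ℕ.≤? #nonfaces σ k (2 ℕ.^ n)
  ... | yes le = le
  ... | no ¬le = ⊥-elim (contra id)
    where
    p = nonface τ k (2 ℕ.^ n)
    R = List.lookup (subsets p)
    R-elim : ∀ i → τ (R i) ≡ false × card (R i) ≡ k × w (R i) ℕ.< 2 ℕ.^ n
    R-elim i = nonface-elim τ (R i) (subsets-lookup p i)
    contra : ¬ ¬ ⊥
    contra = do
      F ← ¬¬-∀Fin (#nonfaces τ k (2 ℕ.^ n)) (λ i → init (R i) (proj₁ (R-elim i)))
      let f = λ i → proj₁ (F i)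
      (a , (i , nz) , h) ← dependent (subsets (nonface σ k (2 ℕ.^ n))) (ℕ.≰⇒> ¬le) f
      return (nz (distinct-initials⇒RowsIndependent R (lookup-injective (subsets-unique p)) (λ i → Φ A (f i))
        (λ i → proj₁ (proj₂ (proj₂ (F i))))
        (λ i j → proj₂ (proj₂ (proj₂ (F i))) (R j) (≡.trans (proj₁ (proj₂ (R-elim j))) (≡.sym (proj₁ (proj₂ (R-elim i))))))
        a (λ j → trans (sym (linear-combination (Λ-linear (A ᵗ)) a f (R j)))
            (trans (Λ-degree (A ᵗ) (R j) (λ S e → combination≈0 a f (λ i → proj₁ (proj₂ (F i))) h S (≡.trans e (proj₁ (proj₂ (R-elim j))))))
                   (0-homo (Λ-linear (A ᵗ)) {λ _ → 0#} (λ _ → refl) (R j)))) i))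
      where
      combination≈0 : ∀ {r} (a : Fin r → Carrier) (f : Fin r → E n) → (∀ i → VanishesOn σ (f i)) →
        All (λ U → ∑ (λ i → a i * f i U) ≈ 0#) (subsets (nonface σ k (2 ℕ.^ n))) →
        ∀ S → card S ≡ k → ∑ (λ i → a i * f i S) ≈ 0#
      combination≈0 a f fσ h S ce with σ S in e
      ... | true  = VanishesOn-combination a fσ S e
      ... | false = All.lookup h (∈-subsets (nonface σ k (2 ℕ.^ n)) (nonface-intro σ S e ce (w<2^n S)))

  -- The monomials e_R with R ∉ σ lie in J_σ and stay independent under A, because A has a left
  -- inverse.
  #nonfaces≤initial : ∀ {n} (A B : Matrix n) → (B · A) ≈M idM → ∀ {σ τ} → (∀ R → InitialIn A σ R → τ R ≡ false) →
    ∀ k → #nonfaces σ k (2 ℕ.^ n) ℕ.≤ #nonfaces τ k (2 ℕ.^ n)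
  #nonfaces≤initial {n} A B BA≈1 {σ} {τ} init k =
    independent⇒≤#nonfaces A init k (2 ℕ.^ n) (λ i → mono (R i))
      (λ i S σS → mono-≢ {S = R i} {S} λ e → false≢true σS (subst (λ S → σ S ≡ false) e (proj₁ (R-elim i))))
      ind
    where
    p = nonface σ k (2 ℕ.^ n)
    R = List.lookup (subsets p)
    R-elim : ∀ i → σ (R i) ≡ false × card (R i) ≡ k × w (R i) ℕ.< 2 ℕ.^ n
    R-elim i = nonface-elim σ (R i) (subsets-lookup p i)
    ind : ∀ a → (∀ U → card U ≡ k → w U ℕ.< 2 ℕ.^ n → ∑ (λ i → a i * Φ A (mono (R i)) U) ≈ 0#) → ∀ i → a i ≈ 0#
    ind a h j = begin
      a j                                    ≈⟨ *-identityʳ _ ⟨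
      a j * 1#                               ≈⟨ *-congˡ (mono-diag (R j)) ⟨
      a j * mono (R j) (R j)                 ≈⟨ ∑-single j (λ i i≢j → trans (*-congˡ (mono-≢ {S = R i} {R j} (i≢j ∘ lookup-injective (subsets-unique p) i j))) (zeroʳ _)) ⟨
      f (R j)                                ≈⟨ Φ-idM f (R j) ⟨
      Φ idM f (R j)                          ≈⟨ Λ-cong₂ (λ i j → BA≈1 j i) (λ _ → refl) (R j) ⟨
      Φ (B · A) f (R j)                      ≈⟨ Φ-· B A f (R j) ⟨
      Φ B (Φ A f) (R j)                      ≈⟨ Λ-degree (B ᵗ) (R j) (λ S e → trans (linear-combination (Λ-linear (A ᵗ)) a _ S)
                                                   (h S (≡.trans e (proj₁ (proj₂ (R-elim j)))) (w<2^n S))) ⟩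
      Φ B (λ _ → 0#) (R j)                   ≈⟨ 0-homo (Λ-linear (B ᵗ)) (λ _ → refl) (R j) ⟩
      0#                                     ∎
      where
      f : E n
      f S = ∑ (λ i → a i * mono (R i) S)

-- Degeneration to the initial ideal and passage to generic coordinates

module Degeneration {c ℓ : Level} (F : Field c ℓ) (inf : Infinite F) where
  open Field F hiding (zero)
  open Ext F
  open LinearAlgebra F
  open Eventual inf
  open Exterior F
  open Shifting F
  open Linear
  open import Algebra.Properties.Semiring.Exp semiring using (_^_; ^-homo-*)

  IsPoly-^ : ∀ m → IsPoly (λ t → t ^ m)
  IsPoly-^ zero    = IsPoly-const 1#
  IsPoly-^ (suc m) = IsPoly-* IsPoly-id (IsPoly-^ m)

  IsPoly-∑S : ∀ {n} {f : Carrier → Subset n → Carrier} → (∀ S → IsPoly (λ t → f t S)) → IsPoly (λ t → ∑S (f t))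
  IsPoly-∑S {n} h = IsPoly-cong (λ t → reflexive (∑S≡sumL _)) (IsPoly-sumL (allSubsets n) h)

  RowsIndependent-cong : ∀ {r} {M N : Matrix r} → M ≈M N → RowsIndependent M → RowsIndependent N
  RowsIndependent-cong e ind a h = ind a (λ j → trans (∑-cong λ i → *-congˡ (e i j)) (h j))

  Invertible⇒RowsIndependent : ∀ {r} (M : Matrix r) → Invertible M → RowsIndependent M
  Invertible⇒RowsIndependent M (N , MN , _) = rightInverse⇒RowsIndependent M N (λ i j → trans (·≈·M M N i j) (MN i j))

  -- Written with `idM j i`, so that the transpose has literally the shape treated by `Λ-diagonal`.
  -- The exponents `bit j` add up to w(U) on e_U.
  torus : ∀ {n} → Carrier → Matrix n
  torus t i j = t ^ bit j * idM j i

  Φ-torus : ∀ {n} t (f : E n) U → Φ (torus t) f U ≈ t ^ w U * f U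
  Φ-torus t f U = trans (Λ-diagonal (λ i → t ^ bit i) f U) (*-congʳ (monomial-bit U))
    where
    monomial-bit : ∀ {n} (U : Subset n) → monomial (λ i → t ^ bit i) U ≈ t ^ w U
    monomial-bit []                  = refl
    monomial-bit {suc n} (true ∷ U)  = trans (*-congˡ (monomial-bit U)) (sym (^-homo-* t (2 ℕ.^ n) (w U)))
    monomial-bit (false ∷ U)         = monomial-bit U

  line : ∀ {n} → Matrix n → Matrix n → Carrier → Matrix n
  line A B s i j = A i j + s * (B i j + - A i j)

  line-0 : ∀ {n} (A B : Matrix n) → A ≈M line A B 0#
  line-0 A B i j = sym (trans (+-congˡ (zeroˡ _)) (+-identityʳ _))

  line-1 : ∀ {n} (A B : Matrix n) → B ≈M line A B 1#
  line-1 A B i j = sym (begin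
    A i j + 1# * (B i j + - A i j)     ≈⟨ +-congˡ (*-identityˡ _) ⟩
    A i j + (B i j + - A i j)          ≈⟨ solve 3 (λ a b c → a :+ (b :+ c) := b :+ (a :+ c)) refl _ _ _ ⟩
    B i j + (A i j + - A i j)          ≈⟨ +-congˡ (-‿inverseʳ _) ⟩
    B i j + 0#                         ≈⟨ +-identityʳ _ ⟩
    B i j                              ∎)

  IsPoly-line : ∀ {n} (A B : Matrix n) i j → IsPoly (λ s → line A B s i j)
  IsPoly-line A B i j = IsPoly-+ (IsPoly-const _) (IsPoly-* IsPoly-id (IsPoly-const _))

  -- The coefficient 1 makes t^(-w(Q)) λ_t φ(h) tend to e_Q itself, in the degree of Q, rather than
  -- to a multiple of it.
  Monic : ∀ {n} → Matrix n → E n → Subset n → Set ℓ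
  Monic φ h Q = Φ φ h Q ≈ 1# × (∀ U → card U ≡ card Q → w U ℕ.< w Q → Φ φ h U ≈ 0#)

  -- The elements chosen for Q ∈ ρ are junk in J_σ.
  MonicLifts : ∀ {n} → Matrix n → (Subset n → Bool) → (Subset n → Bool) → Set (c ⊔ ℓ)
  MonicLifts {n} φ σ ρ = ∀ Q → Σ (E n) λ h → VanishesOn σ h × (ρ Q ≡ false → Monic φ h Q)

  InitialIn⇒Monic : ∀ {n} (φ : Matrix n) {σ Q} → InitialIn φ σ Q → Σ (E n) λ h → VanishesOn σ h × Monic φ h Q
  InitialIn⇒Monic φ {Q = Q} (f , fσ , nz , below) with inverse (Φ φ f Q) nz
  ... | y , e = (λ S → y * f S) , (λ S σS → trans (*-congˡ (fσ S σS)) (zeroʳ _)) ,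
    trans (*-homo (Λ-linear (φ ᵗ)) y f Q) (trans (*-comm _ _) e) ,
    λ U ce w< → trans (*-homo (Λ-linear (φ ᵗ)) y f U) (trans (*-congˡ (below U ce w<)) (zeroʳ _))

  monicLifts : ∀ {n} (φ : Matrix n) {σ ρ} → (∀ Q → ρ Q ≡ false → ¬ ¬ InitialIn φ σ Q) → ¬ ¬ MonicLifts φ σ ρ
  monicLifts {n} φ {σ} {ρ} init = ¬¬-∀Subset n lift-at
    where
    lift-at : ∀ Q → ¬ ¬ Σ (E n) λ h → VanishesOn σ h × (ρ Q ≡ false → Monic φ h Q)
    lift-at Q with ρ Q in e
    ... | true  = return (zeroE , (λ _ _ → refl) , λ ())
    ... | false = do
      (h , hσ , p) ← ¬¬-map (InitialIn⇒Monic φ) (init Q e)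
      return (h , hσ , λ _ → p)

  -- The family g(t) in λ_t φ(J_σ), polynomial in t, with g(0) = g ∈ J_ρ = in(φ(J_σ)) in degree k.
  module Family {n} (φ : Matrix n) {σ ρ : Subset n → Bool} (H : MonicLifts φ σ ρ) (k : ℕ) (g : E n) (gρ : VanishesOn ρ g) where

    h : Subset n → E n
    h Q = proj₁ (H Q)

    -- Each e_Q in the degree k part of g is replaced by t^(-w(Q)) λ_t φ(h_Q). Truncated subtraction
    -- in the exponent is harmless: where w(U) < w(Q), the coefficient of φ(h_Q) at U is zero.
    family : Carrier → E n
    family t U = ∑S (λ Q → truncate k g Q * (t ^ (w U ℕ.∸ w Q) * Φ φ (h Q) U))

    IsPoly-family : ∀ U → IsPoly (λ t → family t U)
    IsPoly-family U = IsPoly-∑S λ Q → IsPoly-* (IsPoly-const _) (IsPoly-* (IsPoly-^ (w U ℕ.∸ w Q)) (IsPoly-const _))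

    -- Only Q ∉ ρ of size k have a nonzero coefficient in the truncation of g, so the junk values of
    -- `H` never contribute.
    term-cong : ∀ Q {a b} → (card Q ≡ k → ρ Q ≡ false → a ≈ b) → truncate k g Q * a ≈ truncate k g Q * b
    term-cong Q {a} {b} e with card Q ℕ.≟ k
    ... | no ne = trans (vanish a) (sym (vanish b))
      where
      vanish : ∀ a → truncate k g Q * a ≈ 0#
      vanish a = trans (*-congʳ (truncate-≢ g Q ne)) (zeroˡ a)
    ... | yes ce with ρ Q in ρQ
    ...   | false = *-congˡ (e ce ≡.refl)
    ...   | true  = trans (vanish a) (sym (vanish b))
      where
      vanish : ∀ a → truncate k g Q * a ≈ 0#
      vanish a = trans (*-congʳ (truncate-VanishesOn gρ Q ρQ)) (zeroˡ a)

    family-0 : ∀ U → card U ≡ k → family 0# U ≈ g U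
    family-0 U cU = trans (∑S-cong λ Q → term-cong Q (limit Q)) (trans (∑S-mono U (truncate k g)) (truncate-≡ g U cU))
      where
      -- Positive powers of 0 vanish, while `0# ^ 0` is `1#`. Exponent 0 occurs for w(U) = w(Q),
      -- where U = Q and the coefficient is 1, and for w(U) < w(Q), where the coefficient is 0.
      limit : ∀ Q → card Q ≡ k → ρ Q ≡ false → 0# ^ (w U ℕ.∸ w Q) * Φ φ (h Q) U ≈ mono U Q
      limit Q cQ ρQ with ℕ.<-cmp (w U) (w Q)
      ... | tri< lt ne _ = trans (*-congˡ (proj₂ (proj₂ (proj₂ (H Q)) ρQ) U (≡.trans cU (≡.sym cQ)) lt))
                             (trans (zeroʳ _) (sym (mono-≢ {S = U} {Q} (ne ∘ cong w))))
      ... | tri≈ _ e _ with w-injective U Q e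
      ...   | ≡.refl rewrite ℕ.n∸n≡0 (w U) = trans (*-identityˡ _) (trans (proj₁ (proj₂ (proj₂ (H Q)) ρQ)) (sym (mono-diag Q)))
      limit Q cQ ρQ | tri> _ ne gt with w U ℕ.∸ w Q | ℕ.m<n⇒0<n∸m gt
      ... | suc m | _ = trans (*-congʳ (zeroˡ _)) (trans (zeroˡ _) (sym (mono-≢ {S = U} {Q} (ne ∘ cong w))))

    -- Used with u = 1/t, so that `u ^ w Q` is t^(-w(Q)). For t ≠ 0 this element of J_σ is mapped to
    -- the family by λ_t φ in degree k.
    preimage : Carrier → E n
    preimage u S = ∑S (λ Q → truncate k g Q * u ^ w Q * h Q S)

    preimage-VanishesOn : ∀ u → VanishesOn σ (preimage u)
    preimage-VanishesOn u S σS = ∑S-0 λ Q → trans (*-congˡ (proj₁ (proj₂ (H Q)) S σS)) (zeroʳ _)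

    family-preimage : ∀ t u → t * u ≈ 1# → ∀ U → card U ≡ k → Φ (torus t) (Φ φ (preimage u)) U ≈ family t U
    family-preimage t u tu≈1 U cU = begin
      Φ (torus t) (Φ φ (preimage u)) U
        ≈⟨ Φ-torus t _ U ⟩
      t ^ w U * Φ φ (preimage u) U
        ≈⟨ *-congˡ (trans (∑S-homo (Λ-linear (φ ᵗ)) (λ Q S → truncate k g Q * u ^ w Q * h Q S) U)
                          (∑S-cong λ Q → *-homo (Λ-linear (φ ᵗ)) _ (h Q) U)) ⟩
      t ^ w U * ∑S (λ Q → truncate k g Q * u ^ w Q * Φ φ (h Q) U)
        ≈⟨ *-∑S _ _ ⟩
      ∑S (λ Q → t ^ w U * (truncate k g Q * u ^ w Q * Φ φ (h Q) U))
        ≈⟨ ∑S-cong (λ Q → trans (solve 4 (λ a g b x → a :* (g :* b :* x) := g :* (a :* b :* x)) refl _ _ _ _)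
                                (term-cong Q (rescale Q))) ⟩
      family t U ∎
      where
      powers : ∀ m → t ^ m * u ^ m ≈ 1#
      powers zero    = *-identityˡ 1#
      powers (suc m) = begin
        t * t ^ m * (u * u ^ m)      ≈⟨ solve 4 (λ t x u y → t :* x :* (u :* y) := t :* u :* (x :* y)) refl t _ u _ ⟩
        t * u * (t ^ m * u ^ m)      ≈⟨ *-cong tu≈1 (powers m) ⟩
        1# * 1#                      ≈⟨ *-identityˡ 1# ⟩
        1#                           ∎
      rescale : ∀ Q → card Q ≡ k → ρ Q ≡ false →
        t ^ w U * u ^ w Q * Φ φ (h Q) U ≈ t ^ (w U ℕ.∸ w Q) * Φ φ (h Q) U
      rescale Q cQ ρQ with ℕ.≤-total (w Q) (w U)
      ... | inj₁ le = *-congʳ (begin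
        t ^ w U * u ^ w Q                               ≈⟨ *-congʳ (reflexive (cong (t ^_) (≡.sym (ℕ.m∸n+n≡m le)))) ⟩
        t ^ (w U ℕ.∸ w Q ℕ.+ w Q) * u ^ w Q             ≈⟨ *-congʳ (^-homo-* t (w U ℕ.∸ w Q) (w Q)) ⟩
        t ^ (w U ℕ.∸ w Q) * t ^ w Q * u ^ w Q           ≈⟨ *-assoc _ _ _ ⟩
        t ^ (w U ℕ.∸ w Q) * (t ^ w Q * u ^ w Q)         ≈⟨ *-congˡ (powers (w Q)) ⟩
        t ^ (w U ℕ.∸ w Q) * 1#                          ≈⟨ *-identityʳ _ ⟩
        t ^ (w U ℕ.∸ w Q)                               ∎)
      ... | inj₂ ge with ℕ.m≤n⇒m<n∨m≡n ge
      ...   | inj₁ lt = trans (trans (*-congˡ z) (zeroʳ _)) (sym (trans (*-congˡ z) (zeroʳ _)))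
        where
        z : Φ φ (h Q) U ≈ 0#
        z = proj₂ (proj₂ (proj₂ (H Q)) ρQ) U (≡.trans cU (≡.sym cQ)) lt
      ...   | inj₂ e rewrite e | ℕ.n∸n≡0 (w Q) = *-congʳ (powers (w Q))

  -- Semicontinuity of rank. Nonfaces of `δ` yield elements of J_ρ whose images under B have
  -- distinct initial monomials. These elements deform into images of elements of J_σ without losing
  -- independence, and for a matrix in the open set of P the number of independent elements is
  -- bounded by the nonfaces of `τ`.
  #nonfaces-degeneration : ∀ {n} {σ ρ τ δ : Subset n → Bool} (φ : Matrix n) →
    (∀ Q → ρ Q ≡ false → ¬ ¬ InitialIn φ σ Q) →
    (B : Matrix n) → (∀ R → δ R ≡ false → ¬ ¬ InitialIn B ρ R) →
    (P : Poly (Fin n × Fin n)) (A₁ : Matrix n) → InOpen P A₁ →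
    (∀ A → InOpen P A → ∀ R → InitialIn A σ R → τ R ≡ false) →
    ∀ k b → #nonfaces δ k b ℕ.≤ #nonfaces τ k b
  #nonfaces-degeneration {n} {σ} {ρ} {τ} {δ} φ initφ B initB P A₁ (A₁inv , PA₁≉0) generic k b
    with #nonfaces δ k b ℕ.≤? #nonfaces τ k b
  ... | yes le = le
  ... | no ¬le = ⊥-elim (¬¬le ¬le)
    where
    p = nonface δ k b
    r = #nonfaces δ k b
    R : Fin r → Subset n
    R = List.lookup (subsets p)
    R-elim : ∀ i → δ (R i) ≡ false × card (R i) ≡ k × w (R i) ℕ.< b
    R-elim i = nonface-elim δ (R i) (subsets-lookup p i)
    cR : ∀ i → card (R i) ≡ k
    cR i = proj₁ (proj₂ (R-elim i))
    ev : Matrix n → Carrier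
    ev A = evalP (λ v → A (proj₁ v) (proj₂ v)) P
    ¬¬le : ¬ ¬ (r ℕ.≤ #nonfaces τ k b)
    ¬¬le = do
      H ← monicLifts φ initφ
      G ← ¬¬-∀Fin r (λ i → initB (R i) (proj₁ (R-elim i)))
      let module Fam i = Family φ H k (proj₁ (G i)) (proj₁ (proj₂ (G i)))
          M : Carrier → Matrix r
          M t i j = Φ B (Fam.family i t) (R j)
          -- At t = 0 the families are the chosen elements of J_ρ, and their images under B have
          -- distinct initial monomials.
          M0 : RowsIndependent (M 0#)
          M0 = RowsIndependent-cong
                 (λ i j → Λ-degree (B ᵗ) (R j) λ S e → sym (Fam.family-0 i S (≡.trans e (cR j))))
                 (distinct-initials⇒RowsIndependent R (lookup-injective (subsets-unique p)) (λ i → Φ B (proj₁ (G i)))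
                   (λ i → proj₁ (proj₂ (proj₂ (G i))))
                   (λ i j → proj₂ (proj₂ (proj₂ (G i))) (R j) (≡.trans (cR j) (≡.sym (cR i)))))
      ev₁ ← RowsIndependent-eventually M (λ i j → IsPoly-Λ {a = λ _ → B ᵗ} (λ _ _ → IsPoly-const _) (Fam.IsPoly-family i) (R j)) 0# M0
      -- Ensures t ≠ 0, without which λ_t could not be undone by a preimage in J_σ.
      ev₂ ← poly-eventually≉0 IsPoly-id 1# 1≉0
      let (t , Mt , t≉0) = Eventually⇒∃ (Eventually-∩ ev₁ ev₂)
          (u , tu≈1) = inverse t t≉0
          A₀ = B · (torus t · φ)
          f : Fin r → E n
          f i = Fam.preimage i u
          A = line A₀ A₁
          N : Carrier → Matrix r
          N s i j = Φ (A s) (f i) (R j)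
          N0 : RowsIndependent (N 0#)
          N0 = RowsIndependent-cong (λ i j → begin
                 Φ B (Fam.family i t) (R j)
                   ≈⟨ Λ-degree (B ᵗ) (R j) (λ S e → Fam.family-preimage i t u tu≈1 S (≡.trans e (cR j))) ⟨
                 Φ B (Φ (torus t) (Φ φ (f i))) (R j)
                   ≈⟨ ≈-cong (Λ-linear (B ᵗ)) (Φ-· (torus t) φ (f i)) (R j) ⟩
                 Φ B (Φ (torus t · φ) (f i)) (R j)
                   ≈⟨ Φ-· B (torus t · φ) (f i) (R j) ⟩
                 Φ A₀ (f i) (R j)
                   ≈⟨ Λ-cong₂ (λ x y → line-0 A₀ A₁ y x) (λ _ → refl) (R j) ⟩
                 N 0# i j ∎) Mt
      -- At s = 0 the line is at `A₀`, where the coefficient matrix has independent rows; at s = 1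
      -- it is at `A₁`, which is invertible with P nonzero. Each condition spreads from its own
      -- point to almost all s, so one s meets all three.
      ev₃ ← RowsIndependent-eventually N (λ i j → IsPoly-Λ (λ x y → IsPoly-line A₀ A₁ y x) (λ _ → IsPoly-const _) (R j)) 0# N0
      ev₄ ← RowsIndependent-eventually A (IsPoly-line A₀ A₁) 1#
              (RowsIndependent-cong (line-1 A₀ A₁) (Invertible⇒RowsIndependent A₁ A₁inv))
      ev₅ ← poly-eventually≉0 {g = λ s → ev (A s)} (IsPoly-evalP (λ v → IsPoly-line A₀ A₁ (proj₁ v) (proj₂ v)) P) 1#
              (λ e → PA₁≉0 (trans (evalP-cong (λ v → line-1 A₀ A₁ (proj₁ v) (proj₂ v)) P) e))
      let (s , Ns , As , Ps) = Eventually⇒∃ (Eventually-∩ ev₃ (Eventually-∩ ev₄ ev₅))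
      (C , AC , CA) ← RowsIndependent⇒Invertible (A s) As
      let inOpen : InOpen P (A s)
          inOpen = ( (C , (λ i j → trans (sym (·≈·M (A s) C i j)) (AC i j)) , (λ i j → trans (sym (·≈·M C (A s) i j)) (CA i j)))
                   , (λ e → Ps (trans (evalP-cong (λ v → refl) P) e)))
      return (independent⇒≤#nonfaces (A s) (generic (A s) inOpen) k b f (λ i → Fam.preimage-VanishesOn i u)
        (λ a h → Ns a (λ j → h (R j) (cR j) (proj₂ (proj₂ (R-elim j))))))

theorem3p1 : ∀ {c ℓ : Level} (F : Field c ℓ) → Infinite F →
    (n : ℕ) (σ : Subset n → Bool) → IsComplex σ →
    (φ : Ext.Matrix F n) → Ext.Invertible F φ →
    (Δσ Δφσ ΔΔφσ : Subset n → Bool) →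
    Ext.IsΔ F σ Δσ → Ext.IsΔφ F φ σ Δφσ → Ext.IsΔ F Δφσ ΔΔφσ →
    (S : Subset n) → m⪯ S Δσ ≥ m⪯ S ΔΔφσ
theorem3p1 F inf n σ σc φ φinv Δσ Δφσ ΔΔφσ (Δc , P , (A , A∈) , gin) (Δφc , inφ) (ΔΔc , Q , (B , B∈) , gin′) S =
  ℕ.+-cancelʳ-≤ (#nonfaces ΔΔφσ (card S) (2 ℕ.^ n)) _ _ (begin
    m⪯ S ΔΔφσ ℕ.+ #nonfaces ΔΔφσ (card S) (2 ℕ.^ n)   ≡⟨ m⪯-+-#nonfaces ΔΔφσ S ⟩
    total ℕ.+ #nonfaces ΔΔφσ (card S) (w S)           ≤⟨ ℕ.+-monoʳ-≤ total below-S ⟩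
    total ℕ.+ #nonfaces Δσ (card S) (w S)             ≡⟨ m⪯-+-#nonfaces Δσ S ⟨
    m⪯ S Δσ ℕ.+ #nonfaces Δσ (card S) (2 ℕ.^ n)       ≤⟨ ℕ.+-monoʳ-≤ (m⪯ S Δσ) all-nonfaces ⟩
    m⪯ S Δσ ℕ.+ #nonfaces ΔΔφσ (card S) (2 ℕ.^ n)     ∎)
  where
  open ℕ.≤-Reasoning
  open Shifting F
  open Degeneration F inf
  total = length (subsets (λ R → (card R ≡ᵇ card S) ∧ (R ⪯rev S)))
  below-S : #nonfaces ΔΔφσ (card S) (w S) ℕ.≤ #nonfaces Δσ (card S) (w S)
  below-S = #nonfaces-degeneration φ
    (nonface⇒InitialIn φ φinv σc inφ)
    B (nonface⇒InitialIn B (proj₁ B∈) Δφc (gin′ B B∈))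
    P A A∈ (λ A′ A′∈ → InitialIn⇒nonface A′ Δc (gin A′ A′∈)) (card S) (w S)
  leftInverse : ∀ (M : Ext.Matrix F n) ((N , _ , NM≈1) : Ext.Invertible F M) i j → Field._≈_ F (LinearAlgebra._·_ F N M i j) (Ext.idM F i j)
  leftInverse M (N , _ , NM≈1) i j = Field.trans F (LinearAlgebra.·≈·M F N M i j) (NM≈1 i j)
  -- Each of these numbers is the dimension of an ideal in degree |S|, which survives coordinate
  -- changes and passage to initial ideals; the chain records the direction used above.
  all-nonfaces : #nonfaces Δσ (card S) (2 ℕ.^ n) ℕ.≤ #nonfaces ΔΔφσ (card S) (2 ℕ.^ n)
  all-nonfaces = begin
    #nonfaces Δσ (card S) (2 ℕ.^ n)       ≤⟨ #nonfaces-initial≤ A (nonface⇒InitialIn A (proj₁ A∈) σc (gin A A∈)) (card S) ⟩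
    #nonfaces σ (card S) (2 ℕ.^ n)        ≤⟨ #nonfaces≤initial φ (proj₁ φinv) (leftInverse φ φinv) (InitialIn⇒nonface φ Δφc inφ) (card S) ⟩
    #nonfaces Δφσ (card S) (2 ℕ.^ n)      ≤⟨ #nonfaces≤initial B (proj₁ (proj₁ B∈)) (leftInverse B (proj₁ B∈)) (InitialIn⇒nonface B ΔΔc (gin′ B B∈)) (card S) ⟩
    #nonfaces ΔΔφσ (card S) (2 ℕ.^ n)     ∎
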